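{- For integers $k\ge1$ and $n\ge1$, let $c(k,n)$ be the minimum, over all deterministic algorithms that sort $n$ elements in the rank query model in $k$ rounds, of the maximum over inputs of the total number of queries asked. Then $$c(k,n)\ \ge\ \frac{k}{2e}\,n^{1+1/k}-kn.$$
   Context: Rank query model for sorting: there are $n$ items $x_1,\ldots,x_n$ whose ranks $\mathrm{rank}(x_1),\ldots,\mathrm{rank}(x_n)$ form an unknown permutation of $\{1,\ldots,n\}$. A query is a pair $(i,m)$ with $i,m\in\{1,\ldots,n\}$ and asks "How is $\mathrm{rank}(x_i)$ compared to $m$?", with answer "$<$", "$=$" or "$>$". Sorting means determining the rank of every item. An algorithm runs in $k$ rounds if in each of $k$ rounds it submits a set of queries chosen depending only on answers of earlier rounds, then receives all their answers. -}

module Defs where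

open import Data.Bool.Base using (Bool; true; false; T; if_then_else_)
open import Data.Empty using (⊥-elim)
open import Data.Fin.Base using (Fin; zero; suc)
open import Data.Fin.Permutation using (Permutation′; permutation; _⟨$⟩ʳ_; _⟨$⟩ˡ_; inverseˡ; inverseʳ)
import Data.Fin.Properties as Fin
open import Data.Fin.Subset using (Subset; ∣_∣; ⊤; ⊥)
open import Data.Fin.Subset.Properties using (∣p∣≤n)
open import Data.Integer.Base as ℤ using (+_)
import Data.Integer.Properties as ℤ
open import Data.Maybe.Base using (Maybe; just; nothing)
import Data.Maybe.Properties as Maybe
open import Data.Nat.Base as ℕ using (ℕ; zero; suc; NonZero; _!; z≤n; s≤s)
import Data.Nat.Properties as ℕ
open import Data.Nat.Solver using (module +-*-Solver)
open import Data.Product.Base using (Σ; ∃; ∃-syntax; _×_; _,_; proj₁; proj₂)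
open import Data.Rational.Base as ℚ using (ℚ; 0ℚ; 1ℚ; ½; _/_; 1/_; mkℚ)
import Data.Rational.Properties as ℚ
import Data.Rational.Solver as ℚ
open import Data.Rational.Unnormalised.Base as ℚᵘ using (mkℚᵘ)
import Data.Rational.Unnormalised.Properties as ℚᵘ
open import Data.Sum.Base using (_⊎_; inj₁; inj₂)
open import Data.Vec.Base using (Vec; []; _∷_; lookup; tabulate; map; sum; replicate)
import Data.Vec.Properties as Vec
open import Function.Base using (_∘_; const)
open import Relation.Binary.Definitions using (DecidableEquality; tri<; tri≈; tri>)
open import Relation.Binary.PropositionalEquality
open import Relation.Nullary using (Dec; yes; no; ¬_)
open import Relation.Nullary.Decidable using (map′; _×-dec_; _→-dec_; ¬?; decidable-stable)
open import Relation.Nullary.Negation using (contradiction)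
open import Relation.Unary using (Decidable)

private

  frac-≤ : ∀ a b c d → a ℕ.* suc d ℕ.≤ c ℕ.* suc b →
           + a / suc b ℚ.≤ + c / suc d
  frac-≤ a b c d h = ℚ.toℚᵘ-cancel-≤
    (ℚᵘ.≤-trans (ℚᵘ.≤-reflexive (ℚ.toℚᵘ-fromℚᵘ (mkℚᵘ (+ a) b)))
    (ℚᵘ.≤-trans (ℚᵘ.*≤* (subst₂ ℤ._≤_ (ℤ.pos-* a (suc d)) (ℤ.pos-* c (suc b)) (ℤ.+≤+ h)))
                (ℚᵘ.≤-reflexive (ℚᵘ.≃-sym (ℚ.toℚᵘ-fromℚᵘ (mkℚᵘ (+ c) d))))))

  frac-+ : ∀ a b c d →
           + a / suc b ℚ.+ + c / suc d ≡ + (a ℕ.* suc d ℕ.+ c ℕ.* suc b) / (suc b ℕ.* suc d)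
  frac-+ a b c d = ℚ.toℚᵘ-injective
    (ℚᵘ.≃-trans (ℚ.toℚᵘ-homo-+ (+ a / suc b) (+ c / suc d))
    (ℚᵘ.≃-trans (ℚᵘ.+-cong (ℚ.toℚᵘ-fromℚᵘ (mkℚᵘ (+ a) b)) (ℚ.toℚᵘ-fromℚᵘ (mkℚᵘ (+ c) d)))
    (ℚᵘ.≃-trans (ℚᵘ.≃-reflexive (cong (λ z → mkℚᵘ z _) num))
                (ℚᵘ.≃-sym (ℚ.toℚᵘ-fromℚᵘ (mkℚᵘ (+ (a ℕ.* suc d ℕ.+ c ℕ.* suc b)) _))))))
    where
    num : + a ℤ.* + suc d ℤ.+ + c ℤ.* + suc b ≡ + (a ℕ.* suc d ℕ.+ c ℕ.* suc b)
    num = trans (cong₂ ℤ._+_ (sym (ℤ.pos-* a (suc d))) (sym (ℤ.pos-* c (suc b))))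
                (sym (ℤ.pos-+ (a ℕ.* suc d) (c ℕ.* suc b)))

  archimedean : ∀ ε → 0ℚ ℚ.< ε → ∃[ N ] + 1 / suc N ℚ.≤ ε
  archimedean ε@(mkℚ (+ suc p) q _) _ =
    q , subst (+ 1 / suc q ℚ.≤_) (ℚ.↥p/↧p≡p ε)
          (frac-≤ 1 q (suc p) q (ℕ.*-monoˡ-≤ (suc q) (s≤s (z≤n {p}))))
  archimedean (mkℚ (+ 0) q _) (ℚ.*<* (ℤ.+<+ ()))
  archimedean (mkℚ ℤ.-[1+ p ] q _) (ℚ.*<* ())

  1/-anti : ∀ {N m} → N ℕ.≤ m → + 1 / suc m ℚ.≤ + 1 / suc N
  1/-anti {N} {m} h = frac-≤ 1 m 1 N (ℕ.*-monoʳ-≤ 1 (s≤s h))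

  ∣p-q∣≤ : ∀ p q ε → p ℚ.≤ q ℚ.+ ε → q ℚ.≤ p ℚ.+ ε → ℚ.∣ p ℚ.- q ∣ ℚ.≤ ε
  ∣p-q∣≤ p q ε h₁ h₂ with ℚ.∣p∣≡p∨∣p∣≡-p (p ℚ.- q)
  ... | inj₁ eq = begin
    ℚ.∣ p ℚ.- q ∣        ≡⟨ eq ⟩
    p ℚ.- q              ≤⟨ ℚ.+-monoˡ-≤ (ℚ.- q) h₁ ⟩
    q ℚ.+ ε ℚ.- q        ≡⟨ solve 2 (λ q ε → q :+ ε :- q := ε) refl q ε ⟩
    ε                    ∎
    where
    open ℚ.≤-Reasoning
    open ℚ.+-*-Solver
  ... | inj₂ eq = begin
    ℚ.∣ p ℚ.- q ∣        ≡⟨ eq ⟩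
    ℚ.- (p ℚ.- q)        ≡⟨ solve 2 (λ p q → :- (p :- q) := q :- p) refl p q ⟩
    q ℚ.- p              ≤⟨ ℚ.+-monoˡ-≤ (ℚ.- p) h₂ ⟩
    p ℚ.+ ε ℚ.- p        ≡⟨ solve 2 (λ p ε → p :+ ε :- p := ε) refl p ε ⟩
    ε                    ∎
    where
    open ℚ.≤-Reasoning
    open ℚ.+-*-Solver

  *-mono-≤ : ∀ {p q r s} → 0ℚ ℚ.≤ q → 0ℚ ℚ.≤ r → p ℚ.≤ q → r ℚ.≤ s → p ℚ.* r ℚ.≤ q ℚ.* s
  *-mono-≤ {p} {q} {r} {s} 0≤q 0≤r p≤q r≤s =
    ℚ.≤-trans (ℚ.*-monoʳ-≤-nonNeg r {{ℚ.nonNegative 0≤r}} p≤q)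
              (ℚ.*-monoˡ-≤-nonNeg q {{ℚ.nonNegative 0≤q}} r≤s)

  *-pos : ∀ {p q} → 0ℚ ℚ.< p → 0ℚ ℚ.< q → 0ℚ ℚ.< p ℚ.* q
  *-pos {p} {q} 0<p 0<q =
    ℚ.positive⁻¹ _ {{ℚ.pos*pos⇒pos p {{ℚ.positive 0<p}} q {{ℚ.positive 0<q}}}}

  minus-swap : ∀ a b c d → (a ℚ.- b) ℚ.- (c ℚ.- d) ≡ (a ℚ.- c) ℚ.- (b ℚ.- d)
  minus-swap = solve 4 (λ a b c d → (a :- b) :- (c :- d) := (a :- c) :- (b :- d)) refl
    where
    open ℚ.+-*-Solver

  times-split : ∀ a b c d → a ℚ.* b ℚ.- c ℚ.* d ≡ a ℚ.* (b ℚ.- d) ℚ.+ d ℚ.* (a ℚ.- c)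
  times-split = solve 4 (λ a b c d → a :* b :- c :* d := a :* (b :- d) :+ d :* (a :- c)) refl
    where
    open ℚ.+-*-Solver

  inv-split : ∀ a b a⁻ b⁻ → a⁻ ℚ.* (b ℚ.* b⁻) ℚ.- b⁻ ℚ.* (a ℚ.* a⁻) ≡ (ℚ.- (a ℚ.- b)) ℚ.* (a⁻ ℚ.* b⁻)
  inv-split = solve 4 (λ a b a⁻ b⁻ → a⁻ :* (b :* b⁻) :- b⁻ :* (a :* a⁻)
                                 := (:- (a :- b)) :* (a⁻ :* b⁻)) refl
    where
    open ℚ.+-*-Solver

  *-rotate : ∀ a b c → a ℚ.* (b ℚ.* c) ≡ (a ℚ.* c) ℚ.* b
  *-rotate = solve 3 (λ a b c → a :* (b :* c) := (a :* c) :* b) refl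
    where
    open ℚ.+-*-Solver

  *-square : ∀ η d i → η ℚ.* (d ℚ.* d) ℚ.* (i ℚ.* i) ≡ η ℚ.* ((d ℚ.* i) ℚ.* (d ℚ.* i))
  *-square = solve 3 (λ η d i → η :* (d :* d) :* (i :* i) := η :* ((d :* i) :* (d :* i))) refl
    where
    open ℚ.+-*-Solver

  0<½ : 0ℚ ℚ.< ½
  0<½ = ℚ.positive⁻¹ ½

  ½+½ : ∀ ε → ½ ℚ.* ε ℚ.+ ½ ℚ.* ε ≡ ε
  ½+½ ε = trans (sym (ℚ.*-distribʳ-+ ε ½ ½)) (ℚ.*-identityˡ ε)

  inv : ∀ p → 0ℚ ℚ.< p → ℚ
  inv p 0<p = (1/ p) {{ℚ.>-nonZero 0<p}}

  inv-pos : ∀ p (0<p : 0ℚ ℚ.< p) → 0ℚ ℚ.< inv p 0<p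
  inv-pos p 0<p = ℚ.positive⁻¹ _ {{ℚ.1/pos⇒pos p {{ℚ.positive 0<p}}}}

  *-inv : ∀ p (0<p : 0ℚ ℚ.< p) → p ℚ.* inv p 0<p ≡ 1ℚ
  *-inv p 0<p = ℚ.*-inverseʳ p {{ℚ.>-nonZero 0<p}}

  inv-anti : ∀ p q (0<p : 0ℚ ℚ.< p) (0<q : 0ℚ ℚ.< q) → p ℚ.≤ q → inv q 0<q ℚ.≤ inv p 0<p
  inv-anti p q 0<p 0<q p≤q = begin
    q⁻                   ≡⟨ ℚ.*-identityʳ q⁻ ⟨
    q⁻ ℚ.* 1ℚ            ≡⟨ cong (q⁻ ℚ.*_) (*-inv p 0<p) ⟨
    q⁻ ℚ.* (p ℚ.* p⁻)    ≤⟨ ℚ.*-monoˡ-≤-nonNeg q⁻ {{ℚ.nonNegative (ℚ.<⇒≤ (inv-pos q 0<q))}}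
                              (ℚ.*-monoʳ-≤-nonNeg p⁻ {{ℚ.nonNegative (ℚ.<⇒≤ (inv-pos p 0<p))}} p≤q) ⟩
    q⁻ ℚ.* (q ℚ.* p⁻)    ≡⟨ solve 3 (λ a q b → a :* (q :* b) := (q :* a) :* b) refl q⁻ q p⁻ ⟩
    (q ℚ.* q⁻) ℚ.* p⁻    ≡⟨ cong (ℚ._* p⁻) (*-inv q 0<q) ⟩
    1ℚ ℚ.* p⁻            ≡⟨ ℚ.*-identityˡ p⁻ ⟩
    p⁻                   ∎
    where
    open ℚ.≤-Reasoning
    open ℚ.+-*-Solver
    p⁻ = inv p 0<p
    q⁻ = inv q 0<q

IsCauchy : (ℕ → ℚ) → Set
IsCauchy a = ∀ ε → 0ℚ ℚ.< ε →
  ∃[ N ] ∀ m l → N ℕ.≤ m → N ℕ.≤ l → ℚ.∣ a m ℚ.- a l ∣ ℚ.≤ ε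

-- Real numbers are Cauchy sequences of rationals. No quotient is taken:
-- x and y are the same real number when x ≤ᴿ y and y ≤ᴿ x.
record ℝ : Set where
  constructor mkℝ
  field
    seq    : ℕ → ℚ
    cauchy : IsCauchy seq

open ℝ public

infix  4 _≤ᴿ_
infixl 6 _-ᴿ_
infixl 7 _*ᴿ_ _÷ᴿ_

_≤ᴿ_ : ℝ → ℝ → Set
x ≤ᴿ y = ∀ ε → 0ℚ ℚ.< ε → ∃[ N ] ∀ m → N ℕ.≤ m → seq x m ℚ.≤ seq y m ℚ.+ ε

-- x > 0, with a rational witness that x is bounded away from 0.
record Positiveᴿ (x : ℝ) : Set where
  constructor mkPositive
  field
    δ     : ℚ
    0<δ   : 0ℚ ℚ.< δ
    index : ℕ
    bound : ∀ m → index ℕ.≤ m → δ ℚ.≤ seq x m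

private

  eventually-bounded : ∀ x → ∃[ B ] (0ℚ ℚ.< B) × ∃[ N ] ∀ m → N ℕ.≤ m → ℚ.∣ seq x m ∣ ℚ.≤ B
  eventually-bounded x with cauchy x 1ℚ (ℚ.positive⁻¹ 1ℚ)
  ... | N , h = B , 0<B , N , bnd
    where
    open ℚ.≤-Reasoning
    open ℚ.+-*-Solver
    B = 1ℚ ℚ.+ ℚ.∣ seq x N ∣
    0<B : 0ℚ ℚ.< B
    0<B = ℚ.+-mono-<-≤ (ℚ.positive⁻¹ 1ℚ) (ℚ.0≤∣p∣ (seq x N))
    bnd : ∀ m → N ℕ.≤ m → ℚ.∣ seq x m ∣ ℚ.≤ B
    bnd m N≤m = begin
      ℚ.∣ seq x m ∣
        ≡⟨ cong ℚ.∣_∣ (solve 2 (λ a b → a := (a :- b) :+ b) refl (seq x m) (seq x N)) ⟩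
      ℚ.∣ (seq x m ℚ.- seq x N) ℚ.+ seq x N ∣
        ≤⟨ ℚ.∣p+q∣≤∣p∣+∣q∣ (seq x m ℚ.- seq x N) (seq x N) ⟩
      ℚ.∣ seq x m ℚ.- seq x N ∣ ℚ.+ ℚ.∣ seq x N ∣
        ≤⟨ ℚ.+-monoˡ-≤ ℚ.∣ seq x N ∣ (h m N N≤m ℕ.≤-refl) ⟩
      B ∎

  minus-cauchy : ∀ x y → IsCauchy (λ m → seq x m ℚ.- seq y m)
  minus-cauchy x y ε 0<ε
    with cauchy x (½ ℚ.* ε) (*-pos 0<½ 0<ε) | cauchy y (½ ℚ.* ε) (*-pos 0<½ 0<ε)
  ... | N , hx | M , hy = N ℕ.⊔ M , λ m l hm hl → begin
    ℚ.∣ (seq x m ℚ.- seq y m) ℚ.- (seq x l ℚ.- seq y l) ∣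
      ≡⟨ cong ℚ.∣_∣ (minus-swap (seq x m) (seq y m) (seq x l) (seq y l)) ⟩
    ℚ.∣ (seq x m ℚ.- seq x l) ℚ.- (seq y m ℚ.- seq y l) ∣
      ≤⟨ ℚ.∣p-q∣≤∣p∣+∣q∣ (seq x m ℚ.- seq x l) (seq y m ℚ.- seq y l) ⟩
    ℚ.∣ seq x m ℚ.- seq x l ∣ ℚ.+ ℚ.∣ seq y m ℚ.- seq y l ∣
      ≤⟨ ℚ.+-mono-≤ (hx m l (ℕ.m⊔n≤o⇒m≤o N M hm) (ℕ.m⊔n≤o⇒m≤o N M hl))
                    (hy m l (ℕ.m⊔n≤o⇒n≤o N M hm) (ℕ.m⊔n≤o⇒n≤o N M hl)) ⟩
    ½ ℚ.* ε ℚ.+ ½ ℚ.* ε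
      ≡⟨ ½+½ ε ⟩
    ε ∎
    where
    open ℚ.≤-Reasoning
    open ℚ.+-*-Solver

  times-close : ∀ x y ε B C (0<B : 0ℚ ℚ.< B) (0<C : 0ℚ ℚ.< C) N₁ N₂ N₃ N₄ →
    (∀ m → N₁ ℕ.≤ m → ℚ.∣ seq x m ∣ ℚ.≤ B) →
    (∀ m → N₂ ℕ.≤ m → ℚ.∣ seq y m ∣ ℚ.≤ C) →
    (∀ m l → N₃ ℕ.≤ m → N₃ ℕ.≤ l → ℚ.∣ seq x m ℚ.- seq x l ∣ ℚ.≤ ½ ℚ.* ε ℚ.* inv C 0<C) →
    (∀ m l → N₄ ℕ.≤ m → N₄ ℕ.≤ l → ℚ.∣ seq y m ℚ.- seq y l ∣ ℚ.≤ ½ ℚ.* ε ℚ.* inv B 0<B) →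
    ∃[ N ] ∀ m l → N ℕ.≤ m → N ℕ.≤ l → ℚ.∣ seq x m ℚ.* seq y m ℚ.- seq x l ℚ.* seq y l ∣ ℚ.≤ ε
  times-close x y ε B C 0<B 0<C N₁ N₂ N₃ N₄ bx by hx hy = N , λ m l hm hl → begin
    ℚ.∣ seq x m ℚ.* seq y m ℚ.- seq x l ℚ.* seq y l ∣
      ≡⟨ cong ℚ.∣_∣ (times-split (seq x m) (seq y m) (seq x l) (seq y l)) ⟩
    ℚ.∣ seq x m ℚ.* (seq y m ℚ.- seq y l) ℚ.+ seq y l ℚ.* (seq x m ℚ.- seq x l) ∣
      ≤⟨ ℚ.∣p+q∣≤∣p∣+∣q∣ (seq x m ℚ.* (seq y m ℚ.- seq y l)) (seq y l ℚ.* (seq x m ℚ.- seq x l)) ⟩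
    ℚ.∣ seq x m ℚ.* (seq y m ℚ.- seq y l) ∣ ℚ.+ ℚ.∣ seq y l ℚ.* (seq x m ℚ.- seq x l) ∣
      ≤⟨ ℚ.+-mono-≤ (bounded (seq x m) _ B 0<B (bx m (≥₁ hm)) (hy m l (≥₄ hm) (≥₄ hl)))
                    (bounded (seq y l) _ C 0<C (by l (≥₂ hl)) (hx m l (≥₃ hm) (≥₃ hl))) ⟩
    ½ ℚ.* ε ℚ.+ ½ ℚ.* ε
      ≡⟨ ½+½ ε ⟩
    ε ∎
    where
    open ℚ.≤-Reasoning
    open ℚ.+-*-Solver
    N = (N₁ ℕ.⊔ N₂) ℕ.⊔ (N₃ ℕ.⊔ N₄)
    ≥₁ : ∀ {m} → N ℕ.≤ m → N₁ ℕ.≤ m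
    ≥₁ h = ℕ.m⊔n≤o⇒m≤o N₁ N₂ (ℕ.m⊔n≤o⇒m≤o (N₁ ℕ.⊔ N₂) (N₃ ℕ.⊔ N₄) h)
    ≥₂ : ∀ {m} → N ℕ.≤ m → N₂ ℕ.≤ m
    ≥₂ h = ℕ.m⊔n≤o⇒n≤o N₁ N₂ (ℕ.m⊔n≤o⇒m≤o (N₁ ℕ.⊔ N₂) (N₃ ℕ.⊔ N₄) h)
    ≥₃ : ∀ {m} → N ℕ.≤ m → N₃ ℕ.≤ m
    ≥₃ h = ℕ.m⊔n≤o⇒m≤o N₃ N₄ (ℕ.m⊔n≤o⇒n≤o (N₁ ℕ.⊔ N₂) (N₃ ℕ.⊔ N₄) h)
    ≥₄ : ∀ {m} → N ℕ.≤ m → N₄ ℕ.≤ m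
    ≥₄ h = ℕ.m⊔n≤o⇒n≤o N₃ N₄ (ℕ.m⊔n≤o⇒n≤o (N₁ ℕ.⊔ N₂) (N₃ ℕ.⊔ N₄) h)
    bounded : ∀ p q B (0<B : 0ℚ ℚ.< B) → ℚ.∣ p ∣ ℚ.≤ B → ℚ.∣ q ∣ ℚ.≤ ½ ℚ.* ε ℚ.* inv B 0<B →
              ℚ.∣ p ℚ.* q ∣ ℚ.≤ ½ ℚ.* ε
    bounded p q B 0<B hp hq = begin
      ℚ.∣ p ℚ.* q ∣                    ≡⟨ ℚ.∣p*q∣≡∣p∣*∣q∣ p q ⟩
      ℚ.∣ p ∣ ℚ.* ℚ.∣ q ∣              ≤⟨ *-mono-≤ (ℚ.<⇒≤ 0<B) (ℚ.0≤∣p∣ q) hp hq ⟩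
      B ℚ.* (½ ℚ.* ε ℚ.* inv B 0<B)    ≡⟨ *-rotate B (½ ℚ.* ε) (inv B 0<B) ⟩
      (B ℚ.* inv B 0<B) ℚ.* (½ ℚ.* ε)  ≡⟨ cong (ℚ._* (½ ℚ.* ε)) (*-inv B 0<B) ⟩
      1ℚ ℚ.* (½ ℚ.* ε)                 ≡⟨ ℚ.*-identityˡ _ ⟩
      ½ ℚ.* ε                          ∎

  times-cauchy : ∀ x y → IsCauchy (λ m → seq x m ℚ.* seq y m)
  times-cauchy x y ε 0<ε =
    let B , 0<B , N₁ , bx = eventually-bounded x
        C , 0<C , N₂ , by = eventually-bounded y
        N₃ , hx = cauchy x (½ ℚ.* ε ℚ.* inv C 0<C) (*-pos (*-pos 0<½ 0<ε) (inv-pos C 0<C))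
        N₄ , hy = cauchy y (½ ℚ.* ε ℚ.* inv B 0<B) (*-pos (*-pos 0<½ 0<ε) (inv-pos B 0<B))
    in times-close x y ε B C 0<B 0<C N₁ N₂ N₃ N₄ bx by hx hy

  ⊔-pos : ∀ p {δ} → 0ℚ ℚ.< δ → 0ℚ ℚ.< p ℚ.⊔ δ
  ⊔-pos p {δ} 0<δ = ℚ.<-≤-trans 0<δ (ℚ.p≤q⊔p p δ)

  inv-diff : ∀ a b δ η (0<a : 0ℚ ℚ.< a) (0<b : 0ℚ ℚ.< b) (0<δ : 0ℚ ℚ.< δ) → 0ℚ ℚ.≤ η →
             δ ℚ.≤ a → δ ℚ.≤ b → ℚ.∣ a ℚ.- b ∣ ℚ.≤ η ℚ.* (δ ℚ.* δ) →
             ℚ.∣ inv a 0<a ℚ.- inv b 0<b ∣ ℚ.≤ η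
  inv-diff a b δ η 0<a 0<b 0<δ 0≤η δ≤a δ≤b h = begin
    ℚ.∣ a⁻ ℚ.- b⁻ ∣
      ≡⟨ cong ℚ.∣_∣ (cong₂ ℚ._-_ (ℚ.*-identityʳ a⁻) (ℚ.*-identityʳ b⁻)) ⟨
    ℚ.∣ a⁻ ℚ.* 1ℚ ℚ.- b⁻ ℚ.* 1ℚ ∣
      ≡⟨ cong ℚ.∣_∣ (cong₂ (λ u v → a⁻ ℚ.* u ℚ.- b⁻ ℚ.* v) (*-inv b 0<b) (*-inv a 0<a)) ⟨
    ℚ.∣ a⁻ ℚ.* (b ℚ.* b⁻) ℚ.- b⁻ ℚ.* (a ℚ.* a⁻) ∣
      ≡⟨ cong ℚ.∣_∣ (inv-split a b a⁻ b⁻) ⟩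
    ℚ.∣ (ℚ.- (a ℚ.- b)) ℚ.* (a⁻ ℚ.* b⁻) ∣
      ≡⟨ ℚ.∣p*q∣≡∣p∣*∣q∣ (ℚ.- (a ℚ.- b)) (a⁻ ℚ.* b⁻) ⟩
    ℚ.∣ ℚ.- (a ℚ.- b) ∣ ℚ.* ℚ.∣ a⁻ ℚ.* b⁻ ∣
      ≡⟨ cong₂ ℚ._*_ (ℚ.∣-p∣≡∣p∣ (a ℚ.- b)) (ℚ.0≤p⇒∣p∣≡p 0≤a⁻b⁻) ⟩
    ℚ.∣ a ℚ.- b ∣ ℚ.* (a⁻ ℚ.* b⁻)
      ≤⟨ *-mono-≤ 0≤ηδδ 0≤a⁻b⁻ h
           (*-mono-≤ (ℚ.<⇒≤ (inv-pos δ 0<δ)) (ℚ.<⇒≤ (inv-pos b 0<b))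
                     (inv-anti δ a 0<δ 0<a δ≤a) (inv-anti δ b 0<δ 0<b δ≤b)) ⟩
    η ℚ.* (δ ℚ.* δ) ℚ.* (δ⁻ ℚ.* δ⁻)
      ≡⟨ *-square η δ δ⁻ ⟩
    η ℚ.* ((δ ℚ.* δ⁻) ℚ.* (δ ℚ.* δ⁻))
      ≡⟨ cong (λ u → η ℚ.* (u ℚ.* u)) (*-inv δ 0<δ) ⟩
    η ℚ.* (1ℚ ℚ.* 1ℚ)
      ≡⟨ ℚ.*-identityʳ η ⟩
    η ∎
    where
    open ℚ.≤-Reasoning
    open ℚ.+-*-Solver
    a⁻ = inv a 0<a
    b⁻ = inv b 0<b
    δ⁻ = inv δ 0<δ
    0≤a⁻b⁻ : 0ℚ ℚ.≤ a⁻ ℚ.* b⁻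
    0≤a⁻b⁻ = ℚ.<⇒≤ (*-pos (inv-pos a 0<a) (inv-pos b 0<b))
    0≤ηδδ : 0ℚ ℚ.≤ η ℚ.* (δ ℚ.* δ)
    0≤ηδδ = ℚ.≤-trans (ℚ.0≤∣p∣ (a ℚ.- b)) h

  recip-cauchy : ∀ x (x>0 : Positiveᴿ x) →
    IsCauchy (λ m → inv (seq x m ℚ.⊔ Positiveᴿ.δ x>0) (⊔-pos (seq x m) (Positiveᴿ.0<δ x>0)))
  recip-cauchy x (mkPositive δ 0<δ N₁ bnd) ε 0<ε
    with cauchy x (ε ℚ.* (δ ℚ.* δ)) (*-pos 0<ε (*-pos 0<δ 0<δ))
  ... | N₂ , h = N₁ ℕ.⊔ N₂ , λ m l hm hl →
    inv-diff (seq x m ℚ.⊔ δ) (seq x l ℚ.⊔ δ) δ ε (⊔-pos (seq x m) 0<δ) (⊔-pos (seq x l) 0<δ) 0<δ (ℚ.<⇒≤ 0<ε) (ℚ.p≤q⊔p (seq x m) δ) (ℚ.p≤q⊔p (seq x l) δ)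
      (subst₂ (λ u v → ℚ.∣ u ℚ.- v ∣ ℚ.≤ ε ℚ.* (δ ℚ.* δ))
        (sym (ℚ.p≥q⇒p⊔q≡p (bnd m (ℕ.m⊔n≤o⇒m≤o N₁ N₂ hm))))
        (sym (ℚ.p≥q⇒p⊔q≡p (bnd l (ℕ.m⊔n≤o⇒m≤o N₁ N₂ hl))))
        (h m l (ℕ.m⊔n≤o⇒n≤o N₁ N₂ hm) (ℕ.m⊔n≤o⇒n≤o N₁ N₂ hl)))

fromℕ : ℕ → ℝ
fromℕ n = mkℝ (const (+ n / 1)) λ ε 0<ε → 0 , λ _ _ _ _ →
  ℚ.≤-trans (ℚ.≤-reflexive (cong ℚ.∣_∣ (ℚ.+-inverseʳ (+ n / 1)))) (ℚ.<⇒≤ 0<ε)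

_-ᴿ_ : ℝ → ℝ → ℝ
x -ᴿ y = mkℝ (λ m → seq x m ℚ.- seq y m) (minus-cauchy x y)

_*ᴿ_ : ℝ → ℝ → ℝ
x *ᴿ y = mkℝ (λ m → seq x m ℚ.* seq y m) (times-cauchy x y)

-- Taking the maximum with δ changes only finitely many terms and makes
-- every term invertible.
recip : ∀ x → Positiveᴿ x → ℝ
recip x x>0 = mkℝ (λ m → (1/ (seq x m ℚ.⊔ δ)) {{ℚ.>-nonZero (⊔-pos (seq x m) 0<δ)}})
                  (recip-cauchy x x>0)
  where
  open Positiveᴿ x>0

_÷ᴿ_ : ∀ x y → {{Positiveᴿ y}} → ℝ
_÷ᴿ_ x y {{y>0}} = x *ᴿ recip y y>0

*ᴿ-positive : ∀ {x y} → Positiveᴿ x → Positiveᴿ y → Positiveᴿ (x *ᴿ y)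
*ᴿ-positive (mkPositive δ 0<δ N h) (mkPositive δ′ 0<δ′ N′ h′) =
  mkPositive (δ ℚ.* δ′) (*-pos 0<δ 0<δ′) (N ℕ.⊔ N′) λ m hm →
    *-mono-≤ (ℚ.≤-trans (ℚ.<⇒≤ 0<δ) (h m (ℕ.m⊔n≤o⇒m≤o N N′ hm))) (ℚ.<⇒≤ 0<δ′)
             (h m (ℕ.m⊔n≤o⇒m≤o N N′ hm)) (h′ m (ℕ.m⊔n≤o⇒n≤o N N′ hm))

-- Σ_{j ≤ m} 1/j!
e-seq : ℕ → ℚ
e-seq zero    = 1ℚ
e-seq (suc m) = e-seq m ℚ.+ (+ 1 / (suc m) !) {{suc m ℕ.!≢0}}

private

  1/-nonneg : ∀ d .{{_ : NonZero d}} → 0ℚ ℚ.≤ + 1 / d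
  1/-nonneg (suc d) = frac-≤ 0 0 1 d z≤n

  e-seq-step : ∀ m → e-seq m ℚ.≤ e-seq (suc m)
  e-seq-step m = begin
    e-seq m            ≡⟨ ℚ.+-identityʳ (e-seq m) ⟨
    e-seq m ℚ.+ 0ℚ     ≤⟨ ℚ.+-monoʳ-≤ (e-seq m) (1/-nonneg ((suc m) !) {{suc m ℕ.!≢0}}) ⟩
    e-seq (suc m)      ∎
    where
    open ℚ.≤-Reasoning

  1≤e-seq : ∀ m → 1ℚ ℚ.≤ e-seq m
  1≤e-seq zero    = ℚ.≤-refl
  1≤e-seq (suc m) = ℚ.≤-trans (1≤e-seq m) (e-seq-step m)

  1/-step : ∀ m d .{{_ : NonZero d}} → suc (suc m) ℕ.* suc m ℕ.≤ d →
            + 1 / d ℚ.+ + 1 / suc (suc m) ℚ.≤ + 1 / suc m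
  1/-step m (suc d) h = begin
    + 1 / suc d ℚ.+ + 1 / suc (suc m)
      ≤⟨ ℚ.+-monoˡ-≤ (+ 1 / suc (suc m)) (frac-≤ 1 d 1 _ (ℕ.*-monoʳ-≤ 1 h)) ⟩
    + 1 / (suc (suc m) ℕ.* suc m) ℚ.+ + 1 / suc (suc m)
      ≡⟨ frac-+ 1 _ 1 (suc m) ⟩
    + (1 ℕ.* suc (suc m) ℕ.+ 1 ℕ.* (suc (suc m) ℕ.* suc m)) / (suc (suc m) ℕ.* suc m ℕ.* suc (suc m))
      ≤⟨ frac-≤ (1 ℕ.* suc (suc m) ℕ.+ 1 ℕ.* (suc (suc m) ℕ.* suc m)) _ 1 m
           (ℕ.≤-reflexive (solve 1 (λ m → (con 1 :* (con 2 :+ m) :+ con 1 :* ((con 2 :+ m) :* (con 1 :+ m))) :* (con 1 :+ m)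
              := con 1 :* (((con 2 :+ m) :* (con 1 :+ m)) :* (con 2 :+ m))) refl m)) ⟩
    + 1 / suc m ∎
    where
    open ℚ.≤-Reasoning
    open +-*-Solver

  -- The partial sum plus 1/m is nonincreasing, which bounds the tail.
  e-seq-up-step : ∀ m → e-seq (suc (suc m)) ℚ.+ + 1 / suc (suc m) ℚ.≤ e-seq (suc m) ℚ.+ + 1 / suc m
  e-seq-up-step m = begin
    e-seq (suc m) ℚ.+ t ℚ.+ + 1 / suc (suc m)    ≡⟨ ℚ.+-assoc (e-seq (suc m)) t _ ⟩
    e-seq (suc m) ℚ.+ (t ℚ.+ + 1 / suc (suc m))  ≤⟨ ℚ.+-monoʳ-≤ (e-seq (suc m))
                                                      (1/-step m ((suc (suc m)) !) {{suc (suc m) ℕ.!≢0}} le) ⟩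
    e-seq (suc m) ℚ.+ + 1 / suc m                ∎
    where
    open ℚ.≤-Reasoning
    t = (+ 1 / (suc (suc m)) !) {{suc (suc m) ℕ.!≢0}}
    le : suc (suc m) ℕ.* suc m ℕ.≤ (suc (suc m)) !
    le = ℕ.*-monoʳ-≤ (suc (suc m)) (ℕ.m≤m*n (suc m) (m !) {{m ℕ.!≢0}})

  e-seq-mono : ∀ {N m} → N ℕ.≤′ m → e-seq N ℚ.≤ e-seq m
  e-seq-mono ℕ.≤′-refl     = ℚ.≤-refl
  e-seq-mono (ℕ.≤′-step {n} h) = ℚ.≤-trans (e-seq-mono h) (e-seq-step n)

  e-seq-up : ∀ {N m} → N ℕ.≤′ m → e-seq (suc m) ℚ.+ + 1 / suc m ℚ.≤ e-seq (suc N) ℚ.+ + 1 / suc N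
  e-seq-up ℕ.≤′-refl     = ℚ.≤-refl
  e-seq-up (ℕ.≤′-step {n} h) = ℚ.≤-trans (e-seq-up-step n) (e-seq-up h)

  e-seq-tail : ∀ N m l → suc N ℕ.≤ m → suc N ℕ.≤ l → e-seq m ℚ.≤ e-seq l ℚ.+ + 1 / suc N
  e-seq-tail N (suc m) l (s≤s hm) hl = begin
    e-seq (suc m)                   ≡⟨ ℚ.+-identityʳ (e-seq (suc m)) ⟨
    e-seq (suc m) ℚ.+ 0ℚ            ≤⟨ ℚ.+-monoʳ-≤ (e-seq (suc m)) (1/-nonneg (suc m)) ⟩
    e-seq (suc m) ℚ.+ + 1 / suc m   ≤⟨ e-seq-up (ℕ.≤⇒≤′ hm) ⟩
    e-seq (suc N) ℚ.+ + 1 / suc N   ≤⟨ ℚ.+-monoˡ-≤ (+ 1 / suc N) (e-seq-mono (ℕ.≤⇒≤′ hl)) ⟩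
    e-seq l ℚ.+ + 1 / suc N         ∎
    where
    open ℚ.≤-Reasoning

  e-cauchy : IsCauchy e-seq
  e-cauchy ε 0<ε with archimedean ε 0<ε
  ... | N , h = suc N , λ m l hm hl → ℚ.≤-trans
    (∣p-q∣≤ (e-seq m) (e-seq l) (+ 1 / suc N) (e-seq-tail N m l hm hl) (e-seq-tail N l m hl hm)) h

e : ℝ
e = mkℝ e-seq e-cauchy

e-positive : Positiveᴿ e
e-positive = mkPositive 1ℚ (ℚ.positive⁻¹ 1ℚ) 0 λ m _ → 1≤e-seq m

instance
  2e-positive : Positiveᴿ (fromℕ 2 *ᴿ e)
  2e-positive = *ᴿ-positive {fromℕ 2} {e}
    (mkPositive (+ 2 / 1) (ℚ.positive⁻¹ (+ 2 / 1)) 0 λ _ _ → ℚ.≤-refl) e-positive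

-- The greatest a ≤ b with a ^ k ≤ N (k ≥ 1).
iroot-below : ℕ → ℕ → ℕ → ℕ
iroot-below k N zero    = 0
iroot-below k N (suc b) = if (suc b ℕ.^ k) ℕ.≤ᵇ N then suc b else iroot-below k N b

iroot : ℕ → ℕ → ℕ
iroot k N = iroot-below k N N

private

  iroot-below-≤ : ∀ k N b .{{_ : NonZero k}} → iroot-below k N b ℕ.^ k ℕ.≤ N
  iroot-below-≤ (suc k) N zero = z≤n
  iroot-below-≤ k N (suc b) with (suc b ℕ.^ k) ℕ.≤ᵇ N in eq
  ... | true  = ℕ.≤ᵇ⇒≤ _ _ (subst T (sym eq) _)
  ... | false = iroot-below-≤ k N b

  iroot-below-> : ∀ k N b → N ℕ.< suc b ℕ.^ k → N ℕ.< suc (iroot-below k N b) ℕ.^ k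
  iroot-below-> k N zero    h = h
  iroot-below-> k N (suc b) h with (suc b ℕ.^ k) ℕ.≤ᵇ N in eq
  ... | true  = h
  ... | false = iroot-below-> k N b (ℕ.≰⇒> λ le → subst T eq (ℕ.≤⇒≤ᵇ le))

iroot-≤ : ∀ k N .{{_ : NonZero k}} → iroot k N ℕ.^ k ℕ.≤ N
iroot-≤ k N = iroot-below-≤ k N N

iroot-> : ∀ k N .{{_ : NonZero k}} → N ℕ.< suc (iroot k N) ℕ.^ k
iroot-> k@(suc k′) N = iroot-below-> k N N (ℕ.m≤m*n (suc N) (suc N ℕ.^ k′) {{ℕ.m^n≢0 (suc N) k′}})

-- The k-th root of N rounded down to a multiple of 1/(m+1).
root-seq : ℕ → ℕ → ℕ → ℚ
root-seq k N m = + iroot k (N ℕ.* suc m ℕ.^ k) / suc m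

private

  ^-distrib-* : ∀ k a b → (a ℕ.* b) ℕ.^ k ≡ a ℕ.^ k ℕ.* b ℕ.^ k
  ^-distrib-* zero    a b = refl
  ^-distrib-* (suc k) a b = trans (cong (a ℕ.* b ℕ.*_) (^-distrib-* k a b))
    (solve 4 (λ a b x y → a :* b :* (x :* y) := a :* x :* (b :* y)) refl a b (a ℕ.^ k) (b ℕ.^ k))
    where
    open +-*-Solver

  ^-cancel-< : ∀ k a b → a ℕ.^ k ℕ.< b ℕ.^ k → a ℕ.< b
  ^-cancel-< k a b h = ℕ.≰⇒> λ b≤a → ℕ.<⇒≱ h (ℕ.^-monoˡ-≤ k b≤a)

  root-close : ∀ k N m l .{{_ : NonZero k}} → root-seq k N m ℚ.≤ root-seq k N l ℚ.+ + 1 / suc l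
  root-close k N m l = begin
    + a / suc m                                         ≤⟨ frac-≤ a m (suc b) l (ℕ.<⇒≤ aL<[b+1]M) ⟩
    + suc b / suc l                                     ≤⟨ frac-≤ (suc b) l (b ℕ.* suc l ℕ.+ 1 ℕ.* suc l) (l ℕ.+ l ℕ.* suc l) (ℕ.≤-reflexive
          (solve 2 (λ b l → (con 1 :+ b) :* ((con 1 :+ l) :* (con 1 :+ l))
             := (b :* (con 1 :+ l) :+ con 1 :* (con 1 :+ l)) :* (con 1 :+ l)) refl b l)) ⟩
    + (b ℕ.* suc l ℕ.+ 1 ℕ.* suc l) / (suc l ℕ.* suc l) ≡⟨ frac-+ b l 1 l ⟨
    + b / suc l ℚ.+ + 1 / suc l                         ∎
    where
    open ℚ.≤-Reasoning
    open +-*-Solver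
    a = iroot k (N ℕ.* suc m ℕ.^ k)
    b = iroot k (N ℕ.* suc l ℕ.^ k)
    M^k = suc m ℕ.^ k
    L^k = suc l ℕ.^ k
    powers : (a ℕ.* suc l) ℕ.^ k ℕ.< (suc b ℕ.* suc m) ℕ.^ k
    powers = ℕ.≤-<-trans
      (ℕ.≤-trans (ℕ.≤-reflexive (^-distrib-* k a (suc l)))
      (ℕ.≤-trans (ℕ.*-monoˡ-≤ L^k (iroot-≤ k (N ℕ.* M^k)))
                 (ℕ.≤-reflexive (solve 3 (λ N M L → N :* M :* L := N :* L :* M) refl N M^k L^k))))
      (ℕ.<-≤-trans (ℕ.*-monoˡ-< M^k {{ℕ.m^n≢0 (suc m) k}} (iroot-> k (N ℕ.* L^k)))
                   (ℕ.≤-reflexive (sym (^-distrib-* k (suc b) (suc m)))))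
    aL<[b+1]M : a ℕ.* suc l ℕ.< suc b ℕ.* suc m
    aL<[b+1]M = ^-cancel-< k _ _ powers

  root-cauchy : ∀ k N .{{_ : NonZero k}} → IsCauchy (root-seq k N)
  root-cauchy k N ε 0<ε with archimedean ε 0<ε
  ... | K , h = K , λ m l hm hl → ∣p-q∣≤ (root-seq k N m) (root-seq k N l) ε
    (ℚ.≤-trans (root-close k N m l) (ℚ.+-monoʳ-≤ (root-seq k N l) (ℚ.≤-trans (1/-anti hl) h)))
    (ℚ.≤-trans (root-close k N l m) (ℚ.+-monoʳ-≤ (root-seq k N m) (ℚ.≤-trans (1/-anti hm) h)))

root : ∀ k → .{{NonZero k}} → ℕ → ℝ
root k N = mkℝ (root-seq k N) (root-cauchy k N)

-- n ^[ p / q ] is the q-th root of n ^ p.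
infixr 8 _^[_/_]
_^[_/_] : ℕ → ℕ → ∀ q → .{{NonZero q}} → ℝ
n ^[ p / q ] = root q (n ℕ.^ p)

-- Ranks are 0-based: an input is a permutation π of Fin n, item x_i has
-- rank π ⟨$⟩ʳ i, and the thresholds m also range over Fin n.

data Answer : Set where
  lt eq gt : Answer

answer : ∀ {n} → Fin n → Fin n → Answer
answer r m with Fin.<-cmp r m
... | tri< _ _ _ = lt
... | tri≈ _ _ _ = eq
... | tri> _ _ _ = gt

-- A set of queries (i , m): entry i is the set of all m that x_i is
-- compared to.
QuerySet : ℕ → Set
QuerySet n = Vec (Subset n) n

size : ∀ {n} → QuerySet n → ℕ
size Q = sum (map ∣_∣ Q)

-- The answers received in one round; nothing for pairs not queried.
Answers : ℕ → Set
Answers n = Vec (Vec (Maybe Answer) n) n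

answers : ∀ {n} → QuerySet n → (Fin n → Fin n) → Answers n
answers Q rank = tabulate λ i → tabulate λ m →
  if lookup (lookup Q i) m then just (answer (rank i) m) else nothing

-- A deterministic k-round algorithm is a decision tree of depth k: the
-- query set of a round is a function of the answers along the path to it,
-- i.e. of all answers of earlier rounds. Query sets may be empty.
data Algorithm (n : ℕ) : ℕ → Set where
  output : Vec (Fin n) n → Algorithm n 0
  ask    : ∀ {k} → QuerySet n → (Answers n → Algorithm n k) → Algorithm n (suc k)

run : ∀ {n k} → Algorithm n k → (Fin n → Fin n) → Vec (Fin n) n
run (output o)   rank = o
run (ask Q next) rank = run (next (answers Q rank)) rank

queries : ∀ {n k} → Algorithm n k → (Fin n → Fin n) → ℕ
queries (output o)   rank = 0
queries (ask Q next) rank = size Q ℕ.+ queries (next (answers Q rank)) rank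

Sorts : ∀ {n k} → Algorithm n k → Set
Sorts {n} A = ∀ (π : Permutation′ n) i → lookup (run A (π ⟨$⟩ʳ_)) i ≡ π ⟨$⟩ʳ i

IsMinimum IsMaximum : (ℕ → Set) → ℕ → Set
IsMinimum P m = P m × (∀ x → P x → m ℕ.≤ x)
IsMaximum P m = P m × (∀ x → P x → x ℕ.≤ m)

WorstCase : ∀ {n k} → Algorithm n k → ℕ → Set
WorstCase {n} A = IsMaximum λ q → ∃[ π ] queries A (π ⟨$⟩ʳ_) ≡ q

IsRoundComplexity : ℕ → ℕ → ℕ → Set
IsRoundComplexity k n = IsMinimum λ w → Σ (Algorithm n k) λ A → Sorts A × WorstCase A w

-- The minimum over all algorithms exists constructively: whether some
-- algorithm sorts with at most b queries is decided by exhaustive search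
-- over query sets, answers and outputs, all of which are finite types.

private

  Searchable : Set → Set₁
  Searchable A = ∀ {P : A → Set} → Decidable P → Dec (∃ P)

  search-∀ : ∀ {A} → Searchable A → ∀ {P : A → Set} → Decidable P → Dec (∀ a → P a)
  search-∀ s P? with s (¬? ∘ P?)
  ... | yes (a , ¬Pa) = no λ h → ¬Pa (h a)
  ... | no  h         = yes λ a → decidable-stable (P? a) λ ¬Pa → h (a , ¬Pa)

  search-Bool : Searchable Bool
  search-Bool P? with P? true | P? false
  ... | yes p | _     = yes (true , p)
  ... | no _  | yes p = yes (false , p)
  ... | no ¬p | no ¬q = no λ { (true , p) → ¬p p ; (false , q) → ¬q q }

  search-Answer : Searchable (Maybe Answer)
  search-Answer P? with P? nothing | P? (just lt) | P? (just eq) | P? (just gt)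
  ... | yes p | _ | _ | _ = yes (_ , p)
  ... | no _ | yes p | _ | _ = yes (_ , p)
  ... | no _ | no _ | yes p | _ = yes (_ , p)
  ... | no _ | no _ | no _ | yes p = yes (_ , p)
  ... | no a | no b | no c | no d = no λ
    { (nothing , p) → a p ; (just lt , p) → b p ; (just eq , p) → c p ; (just gt , p) → d p }

  search-Vec : ∀ {A} → Searchable A → ∀ n → Searchable (Vec A n)
  search-Vec s zero    P? = map′ (λ p → [] , p) (λ { ([] , p) → p }) (P? [])
  search-Vec s (suc n) P? = map′ (λ { (a , v , p) → a ∷ v , p }) (λ { (a ∷ v , p) → a , v , p })
    (s λ a → search-Vec s n λ v → P? (a ∷ v))

  search-QuerySet : ∀ n → Searchable (QuerySet n)
  search-QuerySet n = search-Vec (search-Vec search-Bool n) n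

  search-Answers : ∀ n → Searchable (Answers n)
  search-Answers n = search-Vec (search-Vec search-Answer n) n

  search-ranking : ∀ n → Searchable (Vec (Fin n) n)
  search-ranking n = search-Vec Fin.any? n

  _≟ᴬ_ : DecidableEquality Answer
  lt ≟ᴬ lt = yes refl
  lt ≟ᴬ eq = no λ ()
  lt ≟ᴬ gt = no λ ()
  eq ≟ᴬ lt = no λ ()
  eq ≟ᴬ eq = yes refl
  eq ≟ᴬ gt = no λ ()
  gt ≟ᴬ lt = no λ ()
  gt ≟ᴬ eq = no λ ()
  gt ≟ᴬ gt = yes refl

  _≟ᵀ_ : ∀ {n} → DecidableEquality (Answers n)
  _≟ᵀ_ = Vec.≡-dec (Vec.≡-dec (Maybe.≡-dec _≟ᴬ_))

  answers-cong : ∀ {n} (Q : QuerySet n) {r s} → r ≗ s → answers Q r ≡ answers Q s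
  answers-cong Q r≗s = Vec.tabulate-cong λ i → Vec.tabulate-cong λ m →
    cong (λ x → if lookup (lookup Q i) m then just (answer x m) else nothing) (r≗s i)

  run-cong : ∀ {n k} (A : Algorithm n k) {r s} → r ≗ s → run A r ≡ run A s
  run-cong (output o)   r≗s = refl
  run-cong (ask Q next) {r} {s} r≗s rewrite answers-cong Q r≗s = run-cong (next (answers Q s)) r≗s

  queries-cong : ∀ {n k} (A : Algorithm n k) {r s} → r ≗ s → queries A r ≡ queries A s
  queries-cong (output o)   r≗s = refl
  queries-cong (ask Q next) {r} {s} r≗s rewrite answers-cong Q r≗s =
    cong (size Q ℕ.+_) (queries-cong (next (answers Q s)) r≗s)

  Inverses : ∀ {n} → Vec (Fin n) n → Vec (Fin n) n → Set
  Inverses f g = (∀ i → lookup f (lookup g i) ≡ i) × (∀ i → lookup g (lookup f i) ≡ i)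

  IsRanking : ∀ {n} → Vec (Fin n) n → Set
  IsRanking f = ∃ (Inverses f)

  isRanking? : ∀ {n} → Decidable (IsRanking {n})
  isRanking? {n} f = search-ranking n λ g →
    Fin.all? (λ i → lookup f (lookup g i) Fin.≟ i) ×-dec
    Fin.all? (λ i → lookup g (lookup f i) Fin.≟ i)

  toPermutation : ∀ {n} {f : Vec (Fin n) n} → IsRanking f → Permutation′ n
  toPermutation {f = f} (g , fg , gf) = permutation (lookup f) (lookup g) fg gf

  ranking : ∀ {n} → Permutation′ n → Vec (Fin n) n
  ranking π = tabulate (π ⟨$⟩ʳ_)

  lookup-ranking : ∀ {n} (π : Permutation′ n) → lookup (ranking π) ≗ (π ⟨$⟩ʳ_)
  lookup-ranking π = Vec.lookup∘tabulate (π ⟨$⟩ʳ_)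

  isRanking-ranking : ∀ {n} (π : Permutation′ n) → IsRanking (ranking π)
  isRanking-ranking π = tabulate (π ⟨$⟩ˡ_) ,
    (λ i → trans (lookup-ranking π _)
             (trans (cong (π ⟨$⟩ʳ_) (Vec.lookup∘tabulate (π ⟨$⟩ˡ_) i)) (inverseʳ π))) ,
    (λ i → trans (Vec.lookup∘tabulate (π ⟨$⟩ˡ_) _)
             (trans (cong (π ⟨$⟩ˡ_) (lookup-ranking π i)) (inverseˡ π)))

  Good : ∀ {n k} → Algorithm n k → ℕ → Vec (Fin n) n → Set
  Good A b r = (∀ i → lookup (run A (lookup r)) i ≡ lookup r i) × queries A (lookup r) ℕ.≤ b

  GoodOn : ∀ {n} k → (Vec (Fin n) n → Set) → ℕ → Set
  GoodOn {n} k S b = Σ (Algorithm n k) λ A → ∀ r → S r → Good A b r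

  goodOn? : ∀ {n} k {S : Vec (Fin n) n → Set} → Decidable S → ∀ b → Dec (GoodOn k S b)
  goodOn? {n} zero S? b = map′
    (λ { (o , h) → output o , λ r Sr → h r Sr , z≤n })
    (λ { (output o , h) → o , λ r Sr → proj₁ (h r Sr) })
    (search-ranking n λ o → search-∀ (search-ranking n) λ r →
      S? r →-dec Fin.all? λ i → lookup o i Fin.≟ lookup r i)
  goodOn? {n} (suc k) {S} S? b = map′ to from
    (search-QuerySet n λ Q → (size Q ℕ.≤? b) ×-dec
      search-∀ (search-Answers n) λ α →
        goodOn? k (λ r → S? r ×-dec (answers Q (lookup r) ≟ᵀ α)) (b ℕ.∸ size Q))
    where
    Round : QuerySet n → Set
    Round Q = size Q ℕ.≤ b × ∀ α → GoodOn k (λ r → S r × answers Q (lookup r) ≡ α) (b ℕ.∸ size Q)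

    to : ∃ Round → GoodOn (suc k) S b
    to (Q , Q≤b , h) = ask Q (λ α → proj₁ (h α)) , λ r Sr →
      let good = proj₂ (h (answers Q (lookup r))) r (Sr , refl)
      in proj₁ good , ℕ.≤-trans (ℕ.+-monoʳ-≤ (size Q) (proj₂ good))
                                (ℕ.≤-reflexive (ℕ.m+[n∸m]≡n Q≤b))

    from : GoodOn (suc k) S b → ∃ Round
    from (ask Q next , h) with search-ranking n S?
    ... | yes (r₀ , Sr₀) = Q , ℕ.m+n≤o⇒m≤o (size Q) (proj₂ (h r₀ Sr₀)) , λ α →
      next α , λ { r (Sr , refl) → proj₁ (h r Sr) ,
        ℕ.≤-trans (ℕ.≤-reflexive (sym (ℕ.m+n∸m≡n (size Q) _))) (ℕ.∸-monoˡ-≤ (size Q) (proj₂ (h r Sr))) }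
    ... | no ¬S = none , subst (ℕ._≤ b) (sym (size-none n)) z≤n , λ α →
      next α , λ r Sr → ⊥-elim (¬S (r , proj₁ Sr))
      where
      none : QuerySet n
      none = replicate n ⊥
      ∣⊥∣ : ∀ n → ∣ ⊥ {n} ∣ ≡ 0
      ∣⊥∣ zero    = refl
      ∣⊥∣ (suc n) = ∣⊥∣ n
      size-none : ∀ m → sum (map ∣_∣ (replicate m (⊥ {n}))) ≡ 0
      size-none zero    = refl
      size-none (suc m) = cong₂ ℕ._+_ (∣⊥∣ n) (size-none m)

  Feasible : ℕ → ℕ → ℕ → Set
  Feasible k n b = Σ (Algorithm n k) λ A → Sorts A × ∀ (π : Permutation′ n) → queries A (π ⟨$⟩ʳ_) ℕ.≤ b

  feasible? : ∀ k n → Decidable (Feasible k n)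
  feasible? k n b = map′
    (λ { (A , h) → A ,
         (λ π i → trans (cong (λ v → lookup v i) (run-cong A (λ j → sym (lookup-ranking π j))))
                    (trans (proj₁ (h (ranking π) (isRanking-ranking π)) i) (lookup-ranking π i))) ,
         (λ π → ℕ.≤-trans (ℕ.≤-reflexive (queries-cong A (λ j → sym (lookup-ranking π j))))
                          (proj₂ (h (ranking π) (isRanking-ranking π)))) })
    (λ { (A , sorts , h) → A , λ r isR → sorts (toPermutation {f = r} isR) , h (toPermutation {f = r} isR) })
    (goodOn? k isRanking? b)

  minimum : ∀ {P : ℕ → Set} → Decidable P → ∃ P → ∃ (IsMinimum P)
  minimum {P} P? (b , Pb) = go b 0 (λ _ ()) (subst P (sym (ℕ.+-identityʳ b)) Pb)
    where
    go : ∀ d a → (∀ x → x ℕ.< a → ¬ P x) → P (d ℕ.+ a) → ∃ (IsMinimum P)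
    go zero    a below Pa = a , Pa , λ x Px → ℕ.≮⇒≥ λ x<a → below x x<a Px
    go (suc d) a below Pa with P? a
    ... | yes p = a , p , λ x Px → ℕ.≮⇒≥ λ x<a → below x x<a Px
    ... | no ¬p = go d (suc a) below′ (subst P (sym (ℕ.+-suc d a)) Pa)
      where
      below′ : ∀ x → x ℕ.< suc a → ¬ P x
      below′ x (s≤s x≤a) with ℕ.m≤n⇒m<n∨m≡n x≤a
      ... | inj₁ x<a  = below x x<a
      ... | inj₂ refl = ¬p

  maximum : ∀ {P : ℕ → Set} → Decidable P → ∀ b → (∀ x → P x → x ℕ.≤ b) → ∃ P → ∃ (IsMaximum P)
  maximum {P} P? b above (x , Px) with P? b
  ... | yes Pb = b , Pb , above
  maximum {P} P? zero above (x , Px) | no ¬Pb =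
    contradiction (subst P (ℕ.n≤0⇒n≡0 (above x Px)) Px) ¬Pb
  maximum {P} P? (suc b) above (x , Px) | no ¬Pb =
    maximum P? b (λ y Py → ℕ.≤-pred (ℕ.≤∧≢⇒< (above y Py) λ { refl → ¬Pb Py })) (x , Px)

  worstCase : ∀ {n k} (A : Algorithm n k) b → (∀ (π : Permutation′ n) → queries A (π ⟨$⟩ʳ_) ℕ.≤ b) →
              ∃ (WorstCase A)
  worstCase {n} A b h = maximum dec b (λ { _ (π , refl) → h π })
    (_ , permutation (λ i → i) (λ i → i) (λ _ → refl) (λ _ → refl) , refl)
    where
    dec : Decidable (λ q → ∃[ π ] queries A (π ⟨$⟩ʳ_) ≡ q)
    dec q = map′
      (λ { (r , isR , p) → toPermutation {f = r} isR , p })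
      (λ { (π , p) → ranking π , isRanking-ranking π , trans (queries-cong A (lookup-ranking π)) p })
      (search-ranking n λ r → isRanking? r ×-dec (queries A (lookup r) ℕ.≟ q))

  -- Asking every query in the first round determines all ranks.

  size-≤ : ∀ {n m} (Q : Vec (Subset n) m) → sum (map ∣_∣ Q) ℕ.≤ m ℕ.* n
  size-≤ []      = z≤n
  size-≤ (p ∷ Q) = ℕ.+-mono-≤ (∣p∣≤n p) (size-≤ Q)

  queries-≤ : ∀ {n k} (A : Algorithm n k) r → queries A r ℕ.≤ k ℕ.* (n ℕ.* n)
  queries-≤ (output o)   r = z≤n
  queries-≤ (ask Q next) r = ℕ.+-mono-≤ (size-≤ Q) (queries-≤ (next (answers Q r)) r)

  idle : ∀ {n} k → Vec (Fin n) n → Algorithm n k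
  idle     zero    o = output o
  idle {n} (suc k) o = ask (replicate n ⊥) λ _ → idle k o

  run-idle : ∀ {n} k (o : Vec (Fin n) n) r → run (idle k o) r ≡ o
  run-idle zero    o r = refl
  run-idle (suc k) o r = run-idle k o r

  find-eq : ∀ {n} (row : Vec (Maybe Answer) n) → Dec (∃[ m ] lookup row m ≡ just eq)
  find-eq row = Fin.any? λ m → Maybe.≡-dec _≟ᴬ_ (lookup row m) (just eq)

  pick : ∀ {n} {P : Fin n → Set} → Fin n → Dec (∃ P) → Fin n
  pick i (yes (m , _)) = m
  pick i (no _)        = i

  decode : ∀ {n} → Answers n → Vec (Fin n) n
  decode α = tabulate λ i → pick i (find-eq (lookup α i))

  answer-eq : ∀ {n} (r m : Fin n) → answer r m ≡ eq → r ≡ m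
  answer-eq r m h with Fin.<-cmp r m
  ... | tri≈ _ p _ = p

  answer-refl : ∀ {n} (r : Fin n) → answer r r ≡ eq
  answer-refl r with Fin.<-cmp r r
  ... | tri< _ ¬p _ = contradiction refl ¬p
  ... | tri≈ _ _ _ = refl
  ... | tri> _ ¬p _ = contradiction refl ¬p

  everything : ∀ n → QuerySet n
  everything n = replicate n ⊤

  lookup-answers : ∀ {n} (r : Fin n → Fin n) i m →
                   lookup (lookup (answers (everything n) r) i) m ≡ just (answer (r i) m)
  lookup-answers {n} r i m
    rewrite Vec.lookup∘tabulate (λ i → tabulate λ m →
              if lookup (lookup (everything n) i) m then just (answer (r i) m) else nothing) i
          | Vec.lookup∘tabulate (λ m →
              if lookup (lookup (everything n) i) m then just (answer (r i) m) else nothing) m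
          | Vec.lookup-replicate i (⊤ {n})
          | Vec.lookup-replicate m true = refl

  pick-correct : ∀ {n} (r : Fin n → Fin n) i
    (d : Dec (∃[ m ] lookup (lookup (answers (everything n) r) i) m ≡ just eq)) → pick i d ≡ r i
  pick-correct r i (yes (m , p)) =
    sym (answer-eq (r i) m (Maybe.just-injective (trans (sym (lookup-answers r i m)) p)))
  pick-correct r i (no ¬p) =
    contradiction (r i , trans (lookup-answers r i (r i)) (cong just (answer-refl (r i)))) ¬p

  decode-correct : ∀ {n} (r : Fin n → Fin n) i → lookup (decode (answers (everything n) r)) i ≡ r i
  decode-correct {n} r i =
    trans (Vec.lookup∘tabulate (λ j → pick j (find-eq (lookup (answers (everything n) r) j))) i)
          (pick-correct r i (find-eq (lookup (answers (everything n) r) i)))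

  feasible : ∀ k n .{{_ : NonZero k}} → ∃ (Feasible k n)
  feasible (suc k) n = suc k ℕ.* (n ℕ.* n) , A ,
    (λ π i → trans (cong (λ v → lookup v i) (run-idle k (decode (answers (everything n) (π ⟨$⟩ʳ_))) (π ⟨$⟩ʳ_)))
                   (decode-correct (π ⟨$⟩ʳ_) i)) ,
    (λ π → queries-≤ A (π ⟨$⟩ʳ_))
    where
    A : Algorithm n (suc k)
    A = ask (everything n) (idle k ∘ decode)

abstract
  minimum-exists : ∀ k n .{{_ : NonZero k}} → ∃ (IsRoundComplexity k n)
  minimum-exists k n with minimum (feasible? k n) (feasible k n)
  ... | b , (A , sorts , A≤b) , least with worstCase A b A≤b
  ... | w , worst@((π , w≡) , max) =
    w , (A , sorts , worst) , λ { x (A′ , sorts′ , (_ , max′)) →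
      ℕ.≤-trans (subst (ℕ._≤ b) w≡ (A≤b π)) (least x (A′ , sorts′ , λ ρ → max′ _ (ρ , refl))) }

c : ∀ k n → .{{NonZero k}} → ℕ
c k n = proj₁ (minimum-exists k n)

c-isRoundComplexity : ∀ k n .{{_ : NonZero k}} → IsRoundComplexity k n (c k n)
c-isRoundComplexity k n = proj₂ (minimum-exists k n)

{-# OPTIONS --safe #-}

-- Within one round, an item compared to q thresholds has at most 2q + 1
-- possible outcomes, so the n ! rankings are separated only if some run has
-- ∏ (2 q_ij + 1) ≥ n !, the product ranging over all items i and rounds j.
-- By AM-GM a run with T queries gives at most ((2T + kn) / kn) ^ (kn),
-- whence 2T + kn ≥ kn (n !) ^ (1 / kn) ≥ kn (n / e) ^ (1 / k)
-- ≥ kn n ^ (1 / k) / e.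
module Submission where

open import Defs
open import Data.Bool.Base using (true; false; if_then_else_)
open import Data.Fin.Base using (Fin; zero; suc; toℕ; combine; remQuot; punchIn)
open import Data.Fin.Permutation using (Permutation′; insert; insert-punchIn; _⟨$⟩ʳ_; id)
import Data.Fin.Properties as Fin
open import Data.Fin.Subset using (Subset; ∣_∣)
open import Data.Integer.Base as ℤ using (+_)
import Data.Integer.Properties as ℤ
open import Data.List.Base using (List; []; _∷_; length; filter; tabulate)
open import Data.List.Properties using (length-tabulate)
import Data.List.Relation.Binary.Sublist.Propositional.Properties as Sublist
open import Data.List.Relation.Unary.All as All using (All; []; _∷_)
import Data.List.Relation.Unary.All.Properties as All
open import Data.List.Relation.Unary.AllPairs using (AllPairs; []; _∷_)
import Data.List.Relation.Unary.AllPairs.Properties as AllPairs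
open import Data.Maybe.Base using (just; nothing)
open import Data.Nat.Base hiding (_/_)
open import Data.Nat.Properties
open import Data.Nat.Tactic.RingSolver using (solve-∀)
open import Data.Product.Base using (_×_; _,_; proj₁; proj₂)
open import Data.Rational.Base as ℚ using (ℚ; 0ℚ; 1ℚ; _/_; 1/_)
import Data.Rational.Properties as ℚ
import Data.Rational.Solver as ℚ
open import Data.Rational.Unnormalised.Base as ℚᵘ using (mkℚᵘ)
import Data.Rational.Unnormalised.Properties as ℚᵘ
open import Data.Sum.Base using (inj₁; inj₂)
open import Data.Vec.Base using (Vec; []; _∷_; lookup; map; sum)
import Data.Vec.Properties as Vec
open import Function.Base using (_∘_)
open import Relation.Binary.Definitions using (tri<; tri≈; tri>)
open import Relation.Binary.PropositionalEquality
open import Relation.Nullary using (¬_; yes; no)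
open import Relation.Nullary.Decidable using (¬?)
open import Relation.Nullary.Negation using (contradiction)
open import Relation.Unary using (Decidable)

-- Power inequalities: Bernoulli and AM-GM over the natural numbers

^-distribʳ-* : ∀ k a b → (a * b) ^ k ≡ a ^ k * b ^ k
^-distribʳ-* zero    a b = refl
^-distribʳ-* (suc k) a b = trans (cong (a * b *_) (^-distribʳ-* k a b)) (shuffle a b (a ^ k) (b ^ k))
  where
  shuffle : ∀ a b x y → a * b * (x * y) ≡ a * x * (b * y)
  shuffle = solve-∀

^-cancelʳ-≤ : ∀ k {a b} .{{_ : NonZero k}} → a ^ k ≤ b ^ k → a ≤ b
^-cancelʳ-≤ k h = ≮⇒≥ λ b<a → <⇒≱ (^-monoˡ-< k b<a) h

m^m≢0 : ∀ m → NonZero (m ^ m)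
m^m≢0 zero    = _
m^m≢0 (suc m) = m^n≢0 (suc m) (suc m)

2xy≤x²+y² : ∀ x y → 2 * (x * y) ≤ x * x + y * y
2xy≤x²+y² x y with ≤-total x y
... | inj₁ x≤y with d , refl ← m≤n⇒∃[o]m+o≡n x≤y = subst (2 * (x * (x + d)) ≤_) (expand x d) (m≤m+n _ (d * d))
  where
  expand : ∀ x d → 2 * (x * (x + d)) + d * d ≡ x * x + (x + d) * (x + d)
  expand = solve-∀
... | inj₂ y≤x with d , refl ← m≤n⇒∃[o]m+o≡n y≤x = subst (2 * ((y + d) * y) ≤_) (expand y d) (m≤m+n _ (d * d))
  where
  expand : ∀ y d → 2 * ((y + d) * y) + d * d ≡ (y + d) * (y + d) + y * y
  expand = solve-∀

-- Bernoulli's inequality (x / y) ^ (m + 1) ≥ 1 + (m + 1) (x / y - 1) with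
-- denominators cleared.
bernoulli : ∀ m x y → suc m * (x * y ^ m) ≤ x ^ suc m + m * y ^ suc m
bernoulli zero    x y = ≤-reflexive (base x)
  where
  base : ∀ x → 1 * (x * 1) ≡ x * 1 + 0
  base = solve-∀
bernoulli (suc m) x y = +-cancelʳ-≤ (m * (x * (y * y ^ m)) + suc m * (x * x * y ^ m)) _ _ (begin
  suc (suc m) * (x * (y * z)) + (m * (x * (y * z)) + suc m * (x * x * z)) ≡⟨ left m x y z ⟩
  suc m * z * (2 * (x * y)) + x * (suc m * (x * z))
    ≤⟨ +-mono-≤ (*-monoʳ-≤ (suc m * z) (2xy≤x²+y² x y)) (*-monoʳ-≤ x (bernoulli m x y)) ⟩
  suc m * z * (x * x + y * y) + x * (x * x ^ m + m * (y * z))             ≡⟨ right m x y z (x ^ m) ⟩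
  x * (x * x ^ m) + suc m * (y * (y * z)) + (m * (x * (y * z)) + suc m * (x * x * z)) ∎)
  where
  open ≤-Reasoning
  z = y ^ m
  left : ∀ m x y z → suc (suc m) * (x * (y * z)) + (m * (x * (y * z)) + suc m * (x * x * z))
                     ≡ suc m * z * (2 * (x * y)) + x * (suc m * (x * z))
  left = solve-∀
  right : ∀ m x y z w → suc m * z * (x * x + y * y) + x * (x * w + m * (y * z))
                        ≡ x * (x * w) + suc m * (y * (y * z)) + (m * (x * (y * z)) + suc m * (x * x * z))
  right = solve-∀

-- AM-GM for a and k copies of b / k.
am-gm : ∀ k a b → suc k ^ suc k * (a * b ^ k) ≤ k ^ k * (a + b) ^ suc k
am-gm zero a b = ≤-trans (≤-reflexive (base a)) (≤-trans (m≤m+n a b) (≤-reflexive (base′ (a + b))))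
  where
  base : ∀ a → 1 * (a * 1) ≡ a
  base = solve-∀
  base′ : ∀ c → c ≡ 1 * (c * 1)
  base′ = solve-∀
-- Bernoulli's inequality for the ratio k (a + b) / ((k + 1) b).
am-gm k@(suc _) a b = *-cancelˡ-≤ k (+-cancelʳ-≤ (k * (K * b) ^ suc k) _ _ (begin
  k * (K ^ suc k * (a * b ^ k)) + k * (K * b) ^ suc k
    ≡⟨ cong (λ u → k * (K ^ suc k * (a * b ^ k)) + k * u) (^-distribʳ-* (suc k) K b) ⟩
  k * (K * K ^ k * (a * b ^ k)) + k * (K * K ^ k * (b * b ^ k))
    ≡⟨ left k K a b (K ^ k) (b ^ k) ⟩
  K * (k * (a + b) * (K ^ k * b ^ k))
    ≡⟨ cong (λ u → K * (k * (a + b) * u)) (^-distribʳ-* k K b) ⟨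
  K * (k * (a + b) * (K * b) ^ k)
    ≤⟨ bernoulli k (k * (a + b)) (K * b) ⟩
  (k * (a + b)) ^ suc k + k * (K * b) ^ suc k
    ≡⟨ cong (_+ k * (K * b) ^ suc k) (trans (^-distribʳ-* (suc k) k (a + b)) (*-assoc k (k ^ k) _)) ⟩
  k * (k ^ k * (a + b) ^ suc k) + k * (K * b) ^ suc k ∎))
  where
  open ≤-Reasoning
  K = suc k
  left : ∀ k K a b x y → k * (K * x * (a * y)) + k * (K * x * (b * y)) ≡ K * (k * (a + b) * (x * y))
  left = solve-∀

-- Truncated exponentials and the lower bound (n / e) ^ n for the factorial

-- P n m x = n ^ m m! Σ_{j ≤ m} (x / n) ^ j / j!
P : ℕ → ℕ → ℕ → ℕ
P n zero    x = 1
P n (suc m) x = suc m * (n * P n m x) + x ^ suc m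

-- These are the two leading terms of the binomial expansion of the right-hand side.
^-suc-≥ : ∀ m x → x ^ suc m + suc m * x ^ m ≤ suc x ^ suc m
^-suc-≥ zero    x = ≤-reflexive (base x)
  where
  base : ∀ x → x * 1 + 1 ≡ suc x * 1
  base = solve-∀
^-suc-≥ (suc m) x = begin
  x * (x * y) + suc (suc m) * (x * y)             ≤⟨ m≤m+n _ (suc m * y) ⟩
  x * (x * y) + suc (suc m) * (x * y) + suc m * y ≡⟨ expand m x y ⟩
  suc x * (x * y + suc m * y)                     ≤⟨ *-monoʳ-≤ (suc x) (^-suc-≥ m x) ⟩
  suc x * suc x ^ suc m                           ∎
  where
  open ≤-Reasoning
  y = x ^ m
  expand : ∀ m x y → x * (x * y) + suc (suc m) * (x * y) + suc m * y ≡ suc x * (x * y + suc m * y)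
  expand = solve-∀

-- f(x + h) ≥ f(x) + h f′(x) for the truncated exponential, h = 1/n.
P-suc-≥ : ∀ n m x → P n (suc m) x + suc m * P n m x ≤ P n (suc m) (suc x)
P-suc-≥ n zero x = ≤-reflexive (base n x)
  where
  base : ∀ n x → 1 * (n * 1) + x * 1 + 1 * 1 ≡ 1 * (n * 1) + suc x * 1
  base = solve-∀
P-suc-≥ n (suc m) x = begin
  M * (n * P₁) + x ^ M + M * (suc m * (n * P₀) + x ^ suc m) ≡⟨ regroup M n (suc m) P₀ P₁ (x ^ M) (x ^ suc m) ⟩
  M * (n * (P₁ + suc m * P₀)) + (x ^ M + M * x ^ suc m)
    ≤⟨ +-mono-≤ (*-monoʳ-≤ M (*-monoʳ-≤ n (P-suc-≥ n m x))) (^-suc-≥ (suc m) x) ⟩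
  M * (n * P n (suc m) (suc x)) + suc x ^ M                 ∎
  where
  open ≤-Reasoning
  M  = suc (suc m)
  P₀ = P n m x
  P₁ = P n (suc m) x
  regroup : ∀ M n m p q u v → M * (n * q) + u + M * (m * (n * p) + v) ≡ M * (n * (q + m * p)) + (u + M * v)
  regroup = solve-∀

-- (1 + 1/n) ^ m ≤ Σ_{j ≤ m} (m / n) ^ j / j!
[1+n]^m-bound : ∀ n m → suc n ^ m * m ! ≤ P n m m
[1+n]^m-bound n zero    = ≤-refl
[1+n]^m-bound n (suc m) = begin
  suc n * suc n ^ m * (suc m * m !)               ≡⟨ regroup n (suc n ^ m) (suc m) (m !) ⟩
  suc m * (n * (suc n ^ m * m !)) + suc m * (suc n ^ m * m !)
    ≤⟨ +-mono-≤ (*-monoʳ-≤ (suc m) (*-monoʳ-≤ n ([1+n]^m-bound n m))) (*-monoʳ-≤ (suc m) ([1+n]^m-bound n m)) ⟩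
  -- Adding `m ^ suc m` completes the first summand to `P n (suc m) m`; `P-suc-≥` then moves the
  -- argument from `m` to `suc m`.
  suc m * (n * P n m m) + suc m * P n m m         ≤⟨ +-monoˡ-≤ (suc m * P n m m) (m≤m+n (suc m * (n * P n m m)) (m ^ suc m)) ⟩
  P n (suc m) m + suc m * P n m m                 ≤⟨ P-suc-≥ n m m ⟩
  P n (suc m) (suc m)                             ∎
  where
  open ≤-Reasoning
  regroup : ∀ n y m f → suc n * y * (m * f) ≡ m * (n * (y * f)) + m * (y * f)
  regroup = solve-∀

-- m! Σ_{j ≤ m} 1/j!
e-num : ℕ → ℕ
e-num zero    = 1
e-num (suc m) = suc m * e-num m + 1

-- At `x = n` every power of `x / n` is 1, so the truncated exponential turns into a partial sum of
-- the series for e.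
P-diagonal : ∀ n m → P n m n ≡ n ^ m * e-num m
P-diagonal n zero    = refl
P-diagonal n (suc m) = trans (cong (λ u → suc m * (n * u) + n * n ^ m) (P-diagonal n m))
                             (regroup m n (n ^ m) (e-num m))
  where
  regroup : ∀ m n y p → suc m * (n * (y * p)) + n * y ≡ n * y * (suc m * p + 1)
  regroup = solve-∀

-- Each further partial sum `e-num m / m !` gains a positive term; the denominators are
-- cross-multiplied.
e-num-mono : ∀ {n m} → n ≤′ m → e-num n * m ! ≤ e-num m * n !
e-num-mono ≤′-refl             = ≤-refl
e-num-mono {n} (≤′-step {m} h) = begin
  e-num n * (suc m * m !)    ≡⟨ regroup (e-num n) (suc m) (m !) ⟩
  suc m * (e-num n * m !)    ≤⟨ *-monoʳ-≤ (suc m) (e-num-mono h) ⟩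
  suc m * (e-num m * n !)    ≡⟨ *-assoc (suc m) (e-num m) (n !) ⟨
  suc m * e-num m * n !      ≤⟨ *-monoˡ-≤ (n !) (m≤m+n (suc m * e-num m) 1) ⟩
  e-num (suc m) * n !        ∎
  where
  open ≤-Reasoning
  regroup : ∀ p m f → p * (m * f) ≡ m * (p * f)
  regroup = solve-∀

-- The diagonal case gives the partial sum up to `n`, which is then enlarged to the one up to `m`.
-- Having the same `m` for all `n ≤ m` lets the telescoping product in `n^n-bound` use one common
-- approximation of e.
[1+n]^n-bound : ∀ {n m} → n ≤ m → suc n ^ n * m ! ≤ n ^ n * e-num m
[1+n]^n-bound {n} {m} n≤m = *-cancelʳ-≤ _ _ (n !) {{n !≢0}} (begin
  suc n ^ n * m ! * n !       ≡⟨ swap (suc n ^ n) (m !) (n !) ⟩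
  suc n ^ n * n ! * m !       ≤⟨ *-monoˡ-≤ (m !) ([1+n]^m-bound n n) ⟩
  P n n n * m !               ≡⟨ cong (_* m !) (P-diagonal n n) ⟩
  n ^ n * e-num n * m !       ≡⟨ *-assoc (n ^ n) (e-num n) (m !) ⟩
  n ^ n * (e-num n * m !)     ≤⟨ *-monoʳ-≤ (n ^ n) (e-num-mono (≤⇒≤′ n≤m)) ⟩
  n ^ n * (e-num m * n !)     ≡⟨ *-assoc (n ^ n) (e-num m) (n !) ⟨
  n ^ n * e-num m * n !       ∎)
  where
  open ≤-Reasoning
  swap : ∀ a b c → a * b * c ≡ a * c * b
  swap = solve-∀

-- (n / e) ^ n ≤ n !, by telescoping ((n + 1) / n) ^ n ≤ e.
n^n-bound : ∀ {n m} → n ≤ m → n ^ n * (m !) ^ n ≤ n ! * e-num m ^ n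
n^n-bound {zero}  _   = ≤-refl
n^n-bound {suc n} {m} n<m = begin
  suc n * suc n ^ n * (m ! * (m !) ^ n)       ≡⟨ left (suc n) (suc n ^ n) (m !) ((m !) ^ n) ⟩
  suc n * (suc n ^ n * m !) * (m !) ^ n       ≤⟨ *-monoˡ-≤ ((m !) ^ n) (*-monoʳ-≤ (suc n) ([1+n]^n-bound n≤m)) ⟩
  suc n * (n ^ n * e-num m) * (m !) ^ n       ≡⟨ mid (suc n) (n ^ n) (e-num m) ((m !) ^ n) ⟩
  suc n * e-num m * (n ^ n * (m !) ^ n)       ≤⟨ *-monoʳ-≤ (suc n * e-num m) (n^n-bound n≤m) ⟩
  suc n * e-num m * (n ! * e-num m ^ n)       ≡⟨ right (suc n) (e-num m) (n !) (e-num m ^ n) ⟩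
  suc n * n ! * (e-num m * e-num m ^ n)       ∎
  where
  open ≤-Reasoning
  n≤m = <⇒≤ n<m
  left : ∀ a b c d → a * b * (c * d) ≡ a * (b * c) * d
  left = solve-∀
  mid : ∀ a b c d → a * (b * c) * d ≡ a * c * (b * d)
  mid = solve-∀
  right : ∀ a b c d → a * b * (c * d) ≡ a * c * (b * d)
  right = solve-∀

m!≤e-num : ∀ m → m ! ≤ e-num m
m!≤e-num zero    = ≤-refl
m!≤e-num (suc m) = ≤-trans (*-monoʳ-≤ (suc m) (m!≤e-num m)) (m≤m+n _ 1)

-- Outcomes of a single round

-- With w thresholds an item has 2w + 1 possible outcomes: w equalities
-- and w + 1 gaps, numbered in increasing order of the rank.
width : ∀ {n} → Subset n → ℕ
width []          = 0
width (true ∷ p)  = suc (suc (width p))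
width (false ∷ p) = width p

width≡2∣p∣ : ∀ {n} (p : Subset n) → width p ≡ 2 * ∣ p ∣
width≡2∣p∣ []          = refl
width≡2∣p∣ (true ∷ p)  = trans (cong (λ u → 2 + u) (width≡2∣p∣ p)) (sym (*-suc 2 ∣ p ∣))
width≡2∣p∣ (false ∷ p) = width≡2∣p∣ p

-- Odd values are equalities and even values are gaps. A gap containing no rank still keeps its
-- number, which makes the count depend only on the number of thresholds.
outcome : ∀ {n} (p : Subset n) → Fin n → Fin (suc (width p))
outcome (true ∷ p)  zero    = suc zero
outcome (true ∷ p)  (suc r) = suc (suc (outcome p r))
outcome (false ∷ p) zero    = zero
outcome (false ∷ p) (suc r) = outcome p r

answer-suc : ∀ {n} (r m : Fin n) → answer (suc r) (suc m) ≡ answer r m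
answer-suc r m with Fin.<-cmp r m
... | tri< _ _ _ = refl
... | tri≈ _ _ _ = refl
... | tri> _ _ _ = refl

outcome≡0⇒lt : ∀ {n} (p : Subset n) r m → outcome p r ≡ zero → lookup p m ≡ true → answer r m ≡ lt
outcome≡0⇒lt (false ∷ p) zero    (suc m) _ _   = refl
outcome≡0⇒lt (false ∷ p) (suc r) (suc m) h m∈p = trans (answer-suc r m) (outcome≡0⇒lt p r m h m∈p)

-- If exactly one of the two ranks is `zero`, equal outcomes force the head to be `false` and both
-- outcomes to be 0. Both ranks then lie below every threshold, and `outcome≡0⇒lt` applies.
outcome-determines-answer : ∀ {n} (p : Subset n) r s → outcome p r ≡ outcome p s →
                            ∀ m → lookup p m ≡ true → answer r m ≡ answer s m
outcome-determines-answer (b ∷ p)     zero    zero    _ _ _ = refl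
outcome-determines-answer (false ∷ p) zero    (suc s) h (suc m) m∈p =
  sym (trans (answer-suc s m) (outcome≡0⇒lt p s m (sym h) m∈p))
outcome-determines-answer (false ∷ p) (suc r) zero    h (suc m) m∈p =
  trans (answer-suc r m) (outcome≡0⇒lt p r m h m∈p)
outcome-determines-answer (b ∷ p)     (suc r) (suc s) h zero    _   = refl
outcome-determines-answer (b ∷ p)     (suc r) (suc s) h (suc m) m∈p =
  trans (answer-suc r m) (trans (outcome-determines-answer p r s (tail b h) m m∈p) (sym (answer-suc s m)))
  where
  tail : ∀ b → outcome (b ∷ p) (suc r) ≡ outcome (b ∷ p) (suc s) → outcome p r ≡ outcome p s
  tail true  h = Fin.suc-injective (Fin.suc-injective h)
  tail false h = h

outcomes : ∀ {n m} → Vec (Subset n) m → ℕ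
outcomes []      = 1
outcomes (p ∷ Q) = suc (width p) * outcomes Q

jointOutcome : ∀ {n m} (Q : Vec (Subset n) m) → (Fin m → Fin n) → Fin (outcomes Q)
jointOutcome []      r = zero
jointOutcome (p ∷ Q) r = combine (outcome p (r zero)) (jointOutcome Q (r ∘ suc))

jointOutcome-injective : ∀ {n m} (Q : Vec (Subset n) m) r s → jointOutcome Q r ≡ jointOutcome Q s →
                         ∀ i → outcome (lookup Q i) (r i) ≡ outcome (lookup Q i) (s i)
jointOutcome-injective (p ∷ Q) r s h zero    = proj₁ (Fin.combine-injective (outcome p (r zero)) _ (outcome p (s zero)) _ h)
jointOutcome-injective (p ∷ Q) r s h (suc i) =
  jointOutcome-injective Q (r ∘ suc) (s ∘ suc) (proj₂ (Fin.combine-injective (outcome p (r zero)) _ (outcome p (s zero)) _ h)) i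

jointOutcome-determines-answers : ∀ {n} (Q : QuerySet n) r s → jointOutcome Q r ≡ jointOutcome Q s →
                                  answers Q r ≡ answers Q s
jointOutcome-determines-answers Q r s h = Vec.tabulate-cong λ i → Vec.tabulate-cong λ m → entry i m
  where
  entry : ∀ i m → (if lookup (lookup Q i) m then just (answer (r i) m) else nothing)
                  ≡ (if lookup (lookup Q i) m then just (answer (s i) m) else nothing)
  entry i m with lookup (lookup Q i) m in m∈p
  ... | true  = cong just (outcome-determines-answer (lookup Q i) (r i) (s i)
                            (jointOutcome-injective Q r s h i) m m∈p)
  ... | false = refl

-- AM-GM for the `m` factors `2 * ∣ p ∣ + 1`, whose sum is `2 * sum (map ∣_∣ Q) + m`. Items are
-- added one at a time by `am-gm`, with `a` the factor of the new item and `b` the sum of the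
-- others.
outcomes-bound : ∀ {n m} (Q : Vec (Subset n) m) → outcomes Q * m ^ m ≤ (2 * sum (map ∣_∣ Q) + m) ^ m
outcomes-bound [] = ≤-refl
outcomes-bound {m = suc m} (p ∷ Q) = *-cancelˡ-≤ (m ^ m) {{m^m≢0 m}} (begin
  m ^ m * (a * outcomes Q * suc m ^ suc m)    ≡⟨ regroup (m ^ m) a (outcomes Q) (suc m ^ suc m) ⟩
  suc m ^ suc m * (a * (outcomes Q * m ^ m))  ≤⟨ *-monoʳ-≤ (suc m ^ suc m) (*-monoʳ-≤ a (outcomes-bound Q)) ⟩
  suc m ^ suc m * (a * b ^ m)                 ≤⟨ am-gm m a b ⟩
  m ^ m * (a + b) ^ suc m                     ≡⟨ cong (λ u → m ^ m * u ^ suc m) a+b ⟩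
  m ^ m * (2 * (∣ p ∣ + sum (map ∣_∣ Q)) + suc m) ^ suc m ∎)
  where
  open ≤-Reasoning
  a = suc (width p)
  b = 2 * sum (map ∣_∣ Q) + m
  regroup : ∀ x a o y → x * (a * o * y) ≡ y * (a * (o * x))
  regroup = solve-∀
  collect : ∀ c s m → suc (2 * c) + (2 * s + m) ≡ 2 * (c + s) + suc m
  collect = solve-∀
  a+b : a + b ≡ 2 * (∣ p ∣ + sum (map ∣_∣ Q)) + suc m
  a+b = trans (cong (λ u → suc u + b) (width≡2∣p∣ p)) (collect ∣ p ∣ (sum (map ∣_∣ Q)) m)

-- Counting the inputs that a decision tree can separate

length-filter-¬ : ∀ {A : Set} {P : A → Set} (P? : Decidable P) L →
                  length (filter P? L) + length (filter (¬? ∘ P?) L) ≡ length L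
length-filter-¬ P? []      = refl
length-filter-¬ P? (x ∷ L) with P? x
... | yes _ = cong suc (length-filter-¬ P? L)
... | no  _ = trans (+-suc _ _) (cong suc (length-filter-¬ P? L))

-- A pigeonhole count that removes the fibre over the largest code first. The weights `C` and `D`
-- express the bound `D / C` on each fibre without division.
fibres-bound : ∀ {A : Set} N (f : A → ℕ) L C D → All (λ x → f x < N) L →
               (∀ j → length (filter (λ x → f x ≟ j) L) * C ≤ D) → length L * C ≤ N * D
fibres-bound zero    f []      C D []         _      = z≤n
fibres-bound (suc N) f L       C D bound fibres = begin
  length L * C                                ≡⟨ cong (_* C) (length-filter-¬ is-N? L) ⟨
  (length (filter is-N? L) + length L′) * C   ≡⟨ *-distribʳ-+ C (length (filter is-N? L)) (length L′) ⟩
  length (filter is-N? L) * C + length L′ * C ≤⟨ +-mono-≤ (fibres N) (fibres-bound N f L′ C D bound′ fibres′) ⟩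
  D + N * D                                   ∎
  where
  open ≤-Reasoning
  is-N? = λ x → f x ≟ N
  L′ = filter (¬? ∘ is-N?) L
  bound′ : All (λ x → f x < N) L′
  bound′ = All.zipWith (λ { (s≤s fx≤N , fx≢N) → ≤∧≢⇒< fx≤N fx≢N })
             (All.filter⁺ (¬? ∘ is-N?) bound , All.all-filter (¬? ∘ is-N?) L)
  fibres′ : ∀ j → length (filter (λ x → f x ≟ j) L′) * C ≤ D
  fibres′ j = ≤-trans
    (*-monoˡ-≤ C (Sublist.length-mono-≤ (Sublist.filter⁺ (λ x → f x ≟ j) (λ x → f x ≟ j) (λ { refl h → h }) (Sublist.filter-⊆ (¬? ∘ is-N?) L))))
    (fibres j)

-- Here ℓ counts the inputs reaching a round with q queries, o its outcomes,
-- and T bounds the number of queries in the k rounds after it.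
round-bound : ∀ k n T q ℓ o → ℓ * ((k * n) ^ k) ^ n ≤ o * ((2 * T + k * n) ^ k) ^ n →
              o * n ^ n ≤ (2 * q + n) ^ n →
              ℓ * ((suc k * n) ^ suc k) ^ n ≤ ((2 * (q + T) + suc k * n) ^ suc k) ^ n
-- The cancelled factor is what `am-gm` leaves on its right-hand side; it is nonzero also for
-- `k = 0`, since 0 ^ 0 = 1. The inequality is applied to the share `a` of this round and `k` equal
-- shares of `b` for the later rounds.
round-bound k n T q ℓ o h h′ = *-cancelˡ-≤ ((k ^ k) ^ n) {{m^n≢0 (k ^ k) n {{m^m≢0 k}}}} (begin
  (k ^ k) ^ n * (ℓ * ((suc k * n) ^ suc k) ^ n)
    ≡⟨ swap ((k ^ k) ^ n) ℓ (((suc k * n) ^ suc k) ^ n) ⟩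
  ℓ * ((k ^ k) ^ n * ((suc k * n) ^ suc k) ^ n)
    ≡⟨ cong (ℓ *_) (^-distribʳ-* n (k ^ k) ((suc k * n) ^ suc k)) ⟨
  ℓ * (k ^ k * (suc k * n) ^ suc k) ^ n
    ≡⟨ cong (λ u → ℓ * u ^ n) scale ⟩
  ℓ * (K * (n * (k * n) ^ k)) ^ n
    ≡⟨ cong (ℓ *_) (trans (^-distribʳ-* n K _) (cong (K ^ n *_) (^-distribʳ-* n n _))) ⟩
  ℓ * (K ^ n * (n ^ n * ((k * n) ^ k) ^ n))
    ≡⟨ collect ℓ (K ^ n) (n ^ n) (((k * n) ^ k) ^ n) ⟩
  K ^ n * (n ^ n * (ℓ * ((k * n) ^ k) ^ n))
    ≤⟨ *-monoʳ-≤ (K ^ n) (*-monoʳ-≤ (n ^ n) h) ⟩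
  K ^ n * (n ^ n * (o * (b ^ k) ^ n))
    ≡⟨ cong (K ^ n *_) (assoc (n ^ n) o ((b ^ k) ^ n)) ⟩
  K ^ n * (o * n ^ n * (b ^ k) ^ n)
    ≤⟨ *-monoʳ-≤ (K ^ n) (*-monoˡ-≤ ((b ^ k) ^ n) h′) ⟩
  K ^ n * (a ^ n * (b ^ k) ^ n)
    ≡⟨ trans (^-distribʳ-* n K _) (cong (K ^ n *_) (^-distribʳ-* n a _)) ⟨
  (K * (a * b ^ k)) ^ n
    ≤⟨ ^-monoˡ-≤ n (am-gm k a b) ⟩
  (k ^ k * (a + b) ^ suc k) ^ n
    ≡⟨ ^-distribʳ-* n (k ^ k) _ ⟩
  (k ^ k) ^ n * ((a + b) ^ suc k) ^ n
    ≡⟨ cong (λ u → (k ^ k) ^ n * (u ^ suc k) ^ n) (sum-up q n T k) ⟩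
  (k ^ k) ^ n * ((2 * (q + T) + suc k * n) ^ suc k) ^ n ∎)
  where
  open ≤-Reasoning
  K = suc k ^ suc k
  a = 2 * q + n
  b = 2 * T + k * n
  swap : ∀ x y z → x * (y * z) ≡ y * (x * z)
  swap = solve-∀
  collect : ∀ x y z w → x * (y * (z * w)) ≡ y * (z * (x * w))
  collect = solve-∀
  assoc : ∀ x y z → x * (y * z) ≡ y * x * z
  assoc = solve-∀
  sum-up : ∀ q n T k → 2 * q + n + (2 * T + k * n) ≡ 2 * (q + T) + suc k * n
  sum-up = solve-∀
  regroup : ∀ x y n z → x * (y * (n * z)) ≡ y * (n * (x * z))
  regroup = solve-∀
  scale : k ^ k * (suc k * n) ^ suc k ≡ K * (n * (k * n) ^ k)
  scale = ≡-Reasoning.begin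
    k ^ k * (suc k * n) ^ suc k ≡-Reasoning.≡⟨ cong (k ^ k *_) (^-distribʳ-* (suc k) (suc k) n) ⟩
    k ^ k * (K * (n * n ^ k))   ≡-Reasoning.≡⟨ regroup (k ^ k) K n (n ^ k) ⟩
    K * (n * (k ^ k * n ^ k))   ≡-Reasoning.≡⟨ cong (λ u → K * (n * u)) (^-distribʳ-* k k n) ⟨
    K * (n * (k * n) ^ k)       ≡-Reasoning.∎

Distinct : ∀ {n} → List (Fin n → Fin n) → Set
Distinct = AllPairs (λ r s → ¬ r ≗ s)

SortsWithin : ∀ {n k} → Algorithm n k → ℕ → (Fin n → Fin n) → Set
SortsWithin A T r = lookup (run A r) ≗ r × queries A r ≤ T

-- Induction on the rounds. Inputs with the same joint outcome get the same answers and continue in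
-- the same subtree, so the induction hypothesis bounds each fibre, with the queries of this round
-- taken off the budget. A leaf has one output and so is correct for at most one input.
sorted-bound : ∀ k {n} (A : Algorithm n k) T (L : List (Fin n → Fin n)) → Distinct L → All (SortsWithin A T) L →
               length L * ((k * n) ^ k) ^ n ≤ ((2 * T + k * n) ^ k) ^ n
sorted-bound k A T [] _ _ = z≤n
sorted-bound zero {n} (output o) T (r ∷ []) _ _ = ≤-reflexive (+-identityʳ (1 ^ n))
sorted-bound zero (output o) T (r ∷ s ∷ L) ((r≢s ∷ _) ∷ _) ((o≗r , _) ∷ (o≗s , _) ∷ _) =
  contradiction (λ i → trans (sym (o≗r i)) (o≗s i)) r≢s
sorted-bound (suc k) {n} (ask Q next) T L@(r₀ ∷ _) distinct good@((_ , q≤T) ∷ _) =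
  subst (λ u → length L * ((suc k * n) ^ suc k) ^ n ≤ ((2 * u + suc k * n) ^ suc k) ^ n)
    -- The first input of the list witnesses `size Q ≤ T`, so the subtraction in `T′` is not
    -- truncated. This is why the empty list is a case of its own.
    (m+[n∸m]≡n {size Q} (m+n≤o⇒m≤o (size Q) q≤T))
    (round-bound k n T′ (size Q) (length L) (outcomes Q)
      (fibres-bound (outcomes Q) code L _ _ (All.universal (λ r → Fin.toℕ<n (jointOutcome Q r)) L)
        λ j → fibre (filter (λ r → code r ≟ j) L) (AllPairs.filter⁺ (λ r → code r ≟ j) distinct)
                    (All.filter⁺ (λ r → code r ≟ j) good) (All.all-filter (λ r → code r ≟ j) L))
      (outcomes-bound Q))
  where
  T′ = T ∸ size Q
  code : (Fin n → Fin n) → ℕ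
  code r = toℕ (jointOutcome Q r)
  fibre : ∀ {j} L → Distinct L → All (SortsWithin (ask Q next) T) L → All (λ r → code r ≡ j) L →
          length L * ((k * n) ^ k) ^ n ≤ ((2 * T′ + k * n) ^ k) ^ n
  fibre []      _        _    _    = z≤n
  fibre L@(r ∷ _) distinct good same@(r≡j ∷ _) = sorted-bound k (next (answers Q r)) T′ L distinct
    (All.zipWith (λ { {s} ((sorts , within) , s≡j) → after s sorts within (trans s≡j (sym r≡j)) }) (good , same))
    where
    after : ∀ s → lookup (run (next (answers Q s)) s) ≗ s → size Q + queries (next (answers Q s)) s ≤ T →
            code s ≡ code r → SortsWithin (next (answers Q r)) T′ s
    after s sorts within code≡
      rewrite jointOutcome-determines-answers Q s r (Fin.toℕ-injective code≡) =
      sorts , m+n≤o⇒m≤o∸n _ (subst (_≤ T) (+-comm (size Q) _) within)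

-- All permutations as inputs, and the resulting bound on the worst case

-- The index is read in the factorial number system: its leading digit is the image of `zero`, and
-- the remainder encodes the permutation of the other items.
rankings : ∀ n → Fin (n !) → Permutation′ n
rankings zero    _ = id
rankings (suc n) x = insert zero (proj₁ (remQuot {suc n} (n !) x)) (rankings n (proj₂ (remQuot {suc n} (n !) x)))

rankings-injective : ∀ n x y → (rankings n x ⟨$⟩ʳ_) ≗ (rankings n y ⟨$⟩ʳ_) → x ≡ y
rankings-injective zero    zero zero _ = refl
rankings-injective (suc n) x y h = begin
  x                           ≡⟨ Fin.combine-remQuot {suc n} (n !) x ⟨
  combine {suc n} i a ≡⟨ cong₂ combine i≡j (rankings-injective n a b tails) ⟩
  combine {suc n} j b ≡⟨ Fin.combine-remQuot {suc n} (n !) y ⟩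
  y                           ∎
  where
  open ≡-Reasoning
  i = proj₁ (remQuot {suc n} (n !) x)
  a = proj₂ (remQuot {suc n} (n !) x)
  j = proj₁ (remQuot {suc n} (n !) y)
  b = proj₂ (remQuot {suc n} (n !) y)
  i≡j : i ≡ j
  i≡j = h zero
  tails : ∀ l → rankings n a ⟨$⟩ʳ l ≡ rankings n b ⟨$⟩ʳ l
  tails l = Fin.punchIn-injective j _ _ (trans (cong (λ u → punchIn u (rankings n a ⟨$⟩ʳ l)) (sym i≡j))
    (trans (sym (insert-punchIn zero i (rankings n a) l))
    (trans (h (suc l)) (insert-punchIn zero j (rankings n b) l))))

-- `sorted-bound` for the list of all `n !` permutations, with the worst case as the budget.
query-bound : ∀ {k n} (A : Algorithm n k) → Sorts A → ∀ {w} → WorstCase A w →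
              n ! * ((k * n) ^ k) ^ n ≤ ((2 * w + k * n) ^ k) ^ n
query-bound {k} {n} A sorts {w} (_ , max) =
  subst (λ u → u * ((k * n) ^ k) ^ n ≤ ((2 * w + k * n) ^ k) ^ n) (length-tabulate rank)
    (sorted-bound k A w (tabulate rank)
      (AllPairs.tabulate⁺ λ x≢y r≗s → x≢y (rankings-injective n _ _ r≗s))
      (All.tabulate⁺ λ x → sorts (rankings n x) , max _ (rankings n x , refl)))
  where
  rank : Fin (n !) → Fin n → Fin n
  rank x = rankings n x ⟨$⟩ʳ_

-- With `a / suc m` as a lower approximation of n ^ (1 + 1/k) and `e-num m / m !` as one of e, the
-- conclusion is their inequality cleared of denominators. `core` combines the hypothesis with
-- `n ! ≥ (n / e) ^ n` and takes an n-th root; a k-th root follows.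
root-bound : ∀ k n m w a .{{_ : NonZero k}} .{{_ : NonZero n}} → n ≤ m →
             n ! * ((k * n) ^ k) ^ n ≤ ((2 * w + k * n) ^ k) ^ n →
             a ^ k ≤ n ^ suc k * suc m ^ k →
             k * a * m ! ≤ e-num m * (2 * w + k * n) * suc m
root-bound k@(suc k′) n m w a n≤m h a^k≤ = ^-cancelʳ-≤ k (begin
  (k * a * f) ^ k            ≡⟨ trans (^-distribʳ-* k (k * a) f) (cong (_* f ^ k) (^-distribʳ-* k k a)) ⟩
  k ^ k * a ^ k * f ^ k      ≤⟨ *-monoˡ-≤ (f ^ k) (*-monoʳ-≤ (k ^ k) a^k≤) ⟩
  k ^ k * (n * n ^ k * M ^ k) * (f * f ^ k′)
    ≡⟨ left (k ^ k) n (n ^ k) (M ^ k) f (f ^ k′) ⟩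
  n * f * (k ^ k * n ^ k) * (f ^ k′ * M ^ k)
    ≡⟨ cong (λ u → n * f * u * (f ^ k′ * M ^ k)) (^-distribʳ-* k k n) ⟨
  n * f * (k * n) ^ k * (f ^ k′ * M ^ k)
    -- `core` supplies only one factor of the partial sum of e, where the k-th power has `k`. The
    -- other `k′` come from the partial sum being at least 1, which weakens e ^ (1/k) to e.
    ≤⟨ *-mono-≤ core (*-monoˡ-≤ (M ^ k) (^-monoˡ-≤ k′ (m!≤e-num m))) ⟩
  p * b ^ k * (p ^ k′ * M ^ k)
    ≡⟨ right p (b ^ k) (p ^ k′) (M ^ k) ⟩
  p ^ k * b ^ k * M ^ k
    ≡⟨ trans (^-distribʳ-* k (p * b) M) (cong (_* M ^ k) (^-distribʳ-* k p b)) ⟨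
  (p * b * M) ^ k            ∎)
  where
  open ≤-Reasoning
  f = m !
  p = e-num m
  M = suc m
  b = 2 * w + k * n
  c′ = (k * n) ^ k
  left : ∀ x n y z f g → x * (n * y * z) * (f * g) ≡ n * f * (x * y) * (g * z)
  left = solve-∀
  right : ∀ p x q z → p * x * (q * z) ≡ p * q * x * z
  right = solve-∀
  shuffle : ∀ x y z → x * y * z ≡ x * z * y
  shuffle = solve-∀
  core : n * f * c′ ≤ p * b ^ k
  core = ^-cancelʳ-≤ n (begin
    (n * f * c′) ^ n           ≡⟨ trans (^-distribʳ-* n (n * f) c′) (cong (_* c′ ^ n) (^-distribʳ-* n n f)) ⟩
    n ^ n * f ^ n * c′ ^ n     ≤⟨ *-monoˡ-≤ (c′ ^ n) (n^n-bound n≤m) ⟩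
    n ! * p ^ n * c′ ^ n       ≡⟨ shuffle (n !) (p ^ n) (c′ ^ n) ⟩
    n ! * c′ ^ n * p ^ n       ≤⟨ *-monoˡ-≤ (p ^ n) h ⟩
    (b ^ k) ^ n * p ^ n        ≡⟨ *-comm ((b ^ k) ^ n) (p ^ n) ⟩
    p ^ n * (b ^ k) ^ n        ≡⟨ ^-distribʳ-* n p (b ^ k) ⟨
    (p * b ^ k) ^ n            ∎)

-- From natural to rational inequalities

ι : ℕ → ℚ
ι n = + n / 1

ι-toℚᵘ : ∀ n → ℚ.toℚᵘ (ι n) ℚᵘ.≃ mkℚᵘ (+ n) 0
ι-toℚᵘ n = ℚ.toℚᵘ-fromℚᵘ (mkℚᵘ (+ n) 0)

ι-mono : ∀ {m n} → m ≤ n → ι m ℚ.≤ ι n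
ι-mono {m} {n} m≤n = ℚ.toℚᵘ-cancel-≤
  (ℚᵘ.≤-respʳ-≃ (ℚᵘ.≃-sym (ι-toℚᵘ n)) (ℚᵘ.≤-respˡ-≃ (ℚᵘ.≃-sym (ι-toℚᵘ m))
    (ℚᵘ.*≤* (ℤ.*-monoʳ-≤-nonNeg (+ 1) (ℤ.+≤+ m≤n)))))

ι-+ : ∀ m n → ι (m + n) ≡ ι m ℚ.+ ι n
ι-+ m n = ℚ.toℚᵘ-injective
  (ℚᵘ.≃-trans (ι-toℚᵘ (m + n))
  (ℚᵘ.≃-trans (ℚᵘ.*≡* (cong (ℤ._* + 1) (sym (cong₂ ℤ._+_ (ℤ.*-identityʳ (+ m)) (ℤ.*-identityʳ (+ n))))))
  (ℚᵘ.≃-trans (ℚᵘ.≃-sym (ℚᵘ.+-cong (ι-toℚᵘ m) (ι-toℚᵘ n)))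
              (ℚᵘ.≃-sym (ℚ.toℚᵘ-homo-+ (ι m) (ι n))))))

ι-* : ∀ m n → ι (m * n) ≡ ι m ℚ.* ι n
ι-* m n = ℚ.toℚᵘ-injective
  (ℚᵘ.≃-trans (ι-toℚᵘ (m * n))
  (ℚᵘ.≃-trans (ℚᵘ.*≡* (cong (ℤ._* + 1) (ℤ.pos-* m n)))
  (ℚᵘ.≃-trans (ℚᵘ.≃-sym (ℚᵘ.*-cong (ι-toℚᵘ m) (ι-toℚᵘ n)))
              (ℚᵘ.≃-sym (ℚ.toℚᵘ-homo-* (ι m) (ι n))))))

/-*-cancel : ∀ a d .{{_ : NonZero d}} → (+ a / d) ℚ.* ι d ≡ ι a
/-*-cancel a (suc d) = ℚ.toℚᵘ-injective
  (ℚᵘ.≃-trans (ℚ.toℚᵘ-homo-* (+ a / suc d) (ι (suc d)))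
  (ℚᵘ.≃-trans (ℚᵘ.*-cong (ℚ.toℚᵘ-fromℚᵘ (mkℚᵘ (+ a) d)) (ι-toℚᵘ (suc d)))
  (ℚᵘ.≃-trans (ℚᵘ.*≡* (trans (ℤ.*-identityʳ (+ a ℤ.* + suc d))
                              (cong (λ u → + a ℤ.* + u) (sym (*-identityʳ (suc d))))))
              (ℚᵘ.≃-sym (ι-toℚᵘ a)))))

e-seq≡e-num/m! : ∀ m → e-seq m ℚ.* ι (m !) ≡ ι (e-num m)
e-seq≡e-num/m! zero    = ℚ.*-identityˡ (ι 1)
e-seq≡e-num/m! (suc m) = begin
  (e-seq m ℚ.+ t) ℚ.* ι (suc m * m !)
    ≡⟨ ℚ.*-distribʳ-+ (ι (suc m * m !)) (e-seq m) t ⟩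
  e-seq m ℚ.* ι (suc m * m !) ℚ.+ t ℚ.* ι (suc m !)
    ≡⟨ cong₂ ℚ._+_ head (/-*-cancel 1 (suc m !) {{suc m !≢0}}) ⟩
  ι (suc m * e-num m) ℚ.+ ι 1
    ≡⟨ ι-+ (suc m * e-num m) 1 ⟨
  ι (suc m * e-num m + 1) ∎
  where
  open ≡-Reasoning
  open ℚ.+-*-Solver
  t = (+ 1 / suc m !) {{suc m !≢0}}
  head : e-seq m ℚ.* ι (suc m * m !) ≡ ι (suc m * e-num m)
  head = begin
    e-seq m ℚ.* ι (suc m * m !)           ≡⟨ cong (e-seq m ℚ.*_) (ι-* (suc m) (m !)) ⟩
    e-seq m ℚ.* (ι (suc m) ℚ.* ι (m !))
      ≡⟨ solve 3 (λ x y z → x :* (y :* z) := y :* (x :* z)) refl (e-seq m) (ι (suc m)) (ι (m !)) ⟩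
    ι (suc m) ℚ.* (e-seq m ℚ.* ι (m !))   ≡⟨ cong (ι (suc m) ℚ.*_) (e-seq≡e-num/m! m) ⟩
    ι (suc m) ℚ.* ι (e-num m)             ≡⟨ ι-* (suc m) (e-num m) ⟨
    ι (suc m * e-num m)                   ∎

ι-nonNeg : ∀ n → ℚ.NonNegative (ι n)
ι-nonNeg n = ℚ.nonNegative (ι-mono {0} {n} z≤n)

ι-pos : ∀ n .{{_ : NonZero n}} → ℚ.Positive (ι n)
ι-pos (suc n) = ℚ.positive (ℚ.<-≤-trans (ℚ.positive⁻¹ 1ℚ) (ι-mono {1} {suc n} (s≤s z≤n)))

1≤e-seq : ∀ m → 1ℚ ℚ.≤ e-seq m
1≤e-seq m = ℚ.*-cancelʳ-≤-pos (ι (m !)) {{ι-pos (m !) {{m !≢0}}}} (begin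
  1ℚ ℚ.* ι (m !)      ≡⟨ ℚ.*-identityˡ (ι (m !)) ⟩
  ι (m !)             ≤⟨ ι-mono (m!≤e-num m) ⟩
  ι (e-num m)         ≡⟨ e-seq≡e-num/m! m ⟨
  e-seq m ℚ.* ι (m !) ∎)
  where open ℚ.≤-Reasoning

ι[k*r]≤e-seq*ι[b] : ∀ k m a b → k * a * m ! ≤ e-num m * b * suc m →
              ι k ℚ.* (+ a / suc m) ℚ.≤ e-seq m ℚ.* ι b
ι[k*r]≤e-seq*ι[b] k m a b h =
  ℚ.*-cancelʳ-≤-pos (ι (m !)) {{ι-pos (m !) {{m !≢0}}}}
  (ℚ.*-cancelʳ-≤-pos (ι (suc m)) {{ι-pos (suc m)}} (begin
  ι k ℚ.* r ℚ.* ι (m !) ℚ.* ι (suc m)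
    ≡⟨ solve 4 (λ k r f s → k :* r :* f :* s := k :* (r :* s) :* f) refl (ι k) r (ι (m !)) (ι (suc m)) ⟩
  ι k ℚ.* (r ℚ.* ι (suc m)) ℚ.* ι (m !)       ≡⟨ cong (λ u → ι k ℚ.* u ℚ.* ι (m !)) (/-*-cancel a (suc m)) ⟩
  ι k ℚ.* ι a ℚ.* ι (m !)                     ≡⟨ ι-*³ k a (m !) ⟨
  ι (k * a * m !)                             ≤⟨ ι-mono h ⟩
  ι (e-num m * b * suc m)                     ≡⟨ ι-*³ (e-num m) b (suc m) ⟩
  ι (e-num m) ℚ.* ι b ℚ.* ι (suc m)           ≡⟨ cong (λ u → u ℚ.* ι b ℚ.* ι (suc m)) (e-seq≡e-num/m! m) ⟨
  e-seq m ℚ.* ι (m !) ℚ.* ι b ℚ.* ι (suc m)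
    ≡⟨ solve 4 (λ e f b s → e :* f :* b :* s := e :* b :* f :* s) refl (e-seq m) (ι (m !)) (ι b) (ι (suc m)) ⟩
  e-seq m ℚ.* ι b ℚ.* ι (m !) ℚ.* ι (suc m)   ∎))
  where
  open ℚ.≤-Reasoning
  open ℚ.+-*-Solver
  r = + a / suc m
  ι-*³ : ∀ x y z → ι (x * y * z) ≡ ι x ℚ.* ι y ℚ.* ι z
  ι-*³ x y z = trans (ι-* (x * y) z) (cong (ℚ._* ι z) (ι-* x y))

-- Division by 2e and comparison of the real sequences

-- D stands for the denominator 2 e-seq m, which recip clamps from below.
quotient-bound : ∀ k n w r E D .{{_ : ℚ.NonNegative E}} .{{_ : ℚ.Positive D}} .{{_ : ℚ.NonZero D}} →
                 ι 2 ℚ.* E ℚ.≤ D → ι k ℚ.* r ℚ.≤ E ℚ.* ι (2 * w + k * n) →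
                 ι k ℚ.* (1/ D) ℚ.* r ℚ.- ι k ℚ.* ι n ℚ.≤ ι w
quotient-bound k n w r E D 2E≤D h = begin
  ι k ℚ.* (1/ D) ℚ.* r ℚ.- ι k ℚ.* ι n
    ≡⟨ cong (ℚ._- ι k ℚ.* ι n) (solve 3 (λ k d r → k :* d :* r := k :* r :* d) refl (ι k) (1/ D) r) ⟩
  ι k ℚ.* r ℚ.* (1/ D) ℚ.- ι k ℚ.* ι n
    ≤⟨ ℚ.+-monoˡ-≤ (ℚ.- (ι k ℚ.* ι n)) 
         (ℚ.*-monoʳ-≤-nonNeg (1/ D) {{0≤1/D}} kr≤DW) ⟩
  D ℚ.* W ℚ.* (1/ D) ℚ.- ι k ℚ.* ι n
    ≡⟨ cong (ℚ._- ι k ℚ.* ι n) (solve 3 (λ d w i → d :* w :* i := (d :* i) :* w) refl D W (1/ D)) ⟩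
  (D ℚ.* 1/ D) ℚ.* W ℚ.- ι k ℚ.* ι n
    ≡⟨ cong (λ u → u ℚ.* W ℚ.- ι k ℚ.* ι n) (ℚ.*-inverseʳ D) ⟩
  1ℚ ℚ.* W ℚ.- ι k ℚ.* ι n
    ≡⟨ cong (ℚ._- ι k ℚ.* ι n) (ℚ.*-identityˡ W) ⟩
  W ℚ.- ι k ℚ.* ι n
    ≡⟨ cong (ℚ._- ι k ℚ.* ι n) (trans (ι-+ w (k * n)) (cong (ι w ℚ.+_) (ι-* k n))) ⟩
  ι w ℚ.+ ι k ℚ.* ι n ℚ.- ι k ℚ.* ι n
    ≡⟨ solve 2 (λ w x → w :+ x :- x := w) refl (ι w) (ι k ℚ.* ι n) ⟩
  ι w ∎
  where
  open ℚ.≤-Reasoning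
  open ℚ.+-*-Solver
  W = ι (w + k * n)
  0≤1/D : ℚ.NonNegative (1/ D)
  0≤1/D = ℚ.pos⇒nonNeg ((1/ D) {{ℚ.pos⇒nonZero D}}) {{ℚ.1/pos⇒pos D}}
  -- Doubling `k * n` lets the 2 be absorbed into the denominator; it is the reason that kn is
  -- subtracted, in place of kn / 2.
  2w+kn≤2[w+kn] : 2 * w + k * n ≤ 2 * (w + k * n)
  2w+kn≤2[w+kn] = ≤-trans (+-monoʳ-≤ (2 * w) (m≤m+n (k * n) _)) (≤-reflexive (sym (*-distribˡ-+ 2 w (k * n))))
  kr≤DW : ι k ℚ.* r ℚ.≤ D ℚ.* W
  kr≤DW = begin
    ι k ℚ.* r                    ≤⟨ h ⟩
    E ℚ.* ι (2 * w + k * n)      ≤⟨ ℚ.*-monoˡ-≤-nonNeg E (ι-mono 2w+kn≤2[w+kn]) ⟩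
    E ℚ.* ι (2 * (w + k * n))    ≡⟨ cong (E ℚ.*_) (ι-* 2 (w + k * n)) ⟩
    E ℚ.* (ι 2 ℚ.* W)            ≡⟨ solve 3 (λ e t w → e :* (t :* w) := t :* e :* w) refl E (ι 2) W ⟩
    ι 2 ℚ.* E ℚ.* W              ≤⟨ ℚ.*-monoʳ-≤-nonNeg W {{ι-nonNeg (w + k * n)}} 2E≤D ⟩
    D ℚ.* W                      ∎

theorem6 : ∀ (k n : ℕ) .{{_ : NonZero k}} .{{_ : NonZero n}} →
    (fromℕ k ÷ᴿ (fromℕ 2 *ᴿ e)) *ᴿ n ^[ suc k / k ] -ᴿ fromℕ k *ᴿ fromℕ n ≤ᴿ fromℕ (c k n)
-- The witness is `n` because `root-bound` compares with partial sums of e from index `n` on. From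
-- there the inequality holds term by term, and `ε` is merely added at the end.
theorem6 k n ε 0<ε with A , sorts , worst ← proj₁ (c-isRoundComplexity k n) = n , λ m n≤m →
  ℚ.≤-trans
    (quotient-bound k n w (root-seq k (n ^ suc k) m) (e-seq m) _ {{ℚ.nonNegative (0≤e-seq m)}} {{ℚ.positive (0<D m)}} {{ℚ.>-nonZero (0<D m)}}
      (ℚ.p≤p⊔q (ι 2 ℚ.* e-seq m) δ)
      (ι[k*r]≤e-seq*ι[b] k m _ _ (root-bound k n m w _ n≤m (query-bound A sorts worst) (iroot-≤ k _))))
    (ℚ.≤-trans (ℚ.≤-reflexive (sym (ℚ.+-identityʳ (ι w)))) (ℚ.+-monoʳ-≤ (ι w) (ℚ.<⇒≤ 0<ε)))
  where
  w = c k n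
  open Positiveᴿ 2e-positive using (δ; 0<δ)
  0≤e-seq : ∀ m → 0ℚ ℚ.≤ e-seq m
  0≤e-seq m = ℚ.≤-trans (ℚ.nonNegative⁻¹ 1ℚ) (1≤e-seq m)
  0<D : ∀ m → 0ℚ ℚ.< ι 2 ℚ.* e-seq m ℚ.⊔ δ
  0<D m = ℚ.<-≤-trans 0<δ (ℚ.p≤q⊔p (ι 2 ℚ.* e-seq m) δ)
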